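{- There exist at least $53$ pairwise non-isomorphic diminimal polyhedral maps on the torus.
   Context: Graphs are finite, with no loops, no multiple edges and no vertex of valence less than three, and are embedded in the torus. A face of an embedded graph is the closure of a connected component of its complement. An embedded graph together with its embedding is a map if every vertex is at least 3-valent and each face is a closed 2-cell. Two faces meet properly if their intersection is empty or connected. A map on the torus is a toroidal polyhedral map (TPM) if each face is simply connected and each pair of faces meet properly. Edge removing: delete a single edge; if this creates a 2-valent vertex, the two edges adjacent to that vertex are coalesced into one edge. An edge of a TPM is removable if removing it gives a TPM. Edge shrinking: contract an edge so that its two vertices become one vertex; if this creates a two-sided face, the two edges of that face are replaced by a single edge. An edge of a TPM is shrinkable if shrinking it gives a TPM. A TPM is diminimal if it has no removable edges and no shrinkable edges. Two maps are isomorphic if there is a bijection between their vertex sets which preserves adjacency and non-adjacency of vertices and carries faces to faces, preserving adjacency and non-adjacency of faces. -}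

module Defs where

open import Data.Bool.Base using (if_then_else_)
open import Data.Empty using (⊥-elim)
open import Data.Fin.Base using (Fin)
open import Data.Fin.Permutation
  using (Permutation′; _⟨$⟩ʳ_; _⟨$⟩ˡ_; _∘ₚ_; transpose; inverseˡ)
open import Data.Fin.Properties using (_≟_)
open import Data.Nat.Base using (ℕ; _+_)
open import Data.Product using (∃-syntax; _×_; _,_; proj₁)
open import Data.Sum.Base using (_⊎_)
open import Function.Bundles using (Bijection; _⇔_)
open import Level using (0ℓ)
open import Relation.Binary.Bundles using (Setoid)
open import Relation.Binary.Core using (Rel)
open import Relation.Binary.Construct.Closure.Equivalence as Eq
  using (EqClosure)
import Relation.Binary.Construct.On as On
open import Relation.Binary.PropositionalEquality
  using (_≡_; _≢_; refl; sym; trans; cong)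
import Relation.Binary.PropositionalEquality as ≡
open import Relation.Nullary using (¬_; Dec; yes; no; does)
open import Relation.Nullary.Decidable using (_×-dec_; ¬?)

-- A graph with a cellular embedding in a closed oriented surface, given by
-- its rotation system.  Every edge is split into two darts (directed edges).
-- α reverses a dart; σ sends a dart to the next one in the cyclic order around
-- its initial vertex.  An index fixed by α is unused: it stands for no dart
-- and belongs to no vertex, edge or face.  (Unused indices arise when edges
-- are deleted or contracted, so that these operations need no relabelling.)

record EmbeddedGraph (n : ℕ) : Set where
  field
    α σ          : Permutation′ n
    α-involutive : ∀ x → α ⟨$⟩ʳ (α ⟨$⟩ʳ x) ≡ x
    σ-unused     : ∀ x → α ⟨$⟩ʳ x ≡ x → σ ⟨$⟩ʳ x ≡ x

  Ix : Set
  Ix = Fin n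

  rev next along : Ix → Ix
  rev x   = α ⟨$⟩ʳ x
  next x  = σ ⟨$⟩ʳ x
  -- The dart following x on the boundary walk of the face on one fixed side
  -- of x: go along x to its end, then turn to the next dart there.
  along x = next (rev x)

  IsDart : Ix → Set
  IsDart x = rev x ≢ x

  Dart : Set
  Dart = ∃[ x ] IsDart x

  -- Vertices, edges and faces are the orbits of next, rev and along on darts;
  -- the vertex of a dart is its initial vertex.
  SameVertex SameFace : Rel Ix 0ℓ
  SameVertex = EqClosure (λ x y → next x ≡ y)
  SameFace   = EqClosure (λ x y → along x ≡ y)

  Vertices Edges Faces : Setoid 0ℓ 0ℓ
  Vertices = On.setoid (Eq.setoid (λ x y → next x ≡ y)) (proj₁ {B = IsDart})
  Edges    = On.setoid (Eq.setoid (λ x y → rev x ≡ y)) (proj₁ {B = IsDart})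
  Faces    = On.setoid (Eq.setoid (λ x y → along x ≡ y)) (proj₁ {B = IsDart})

  VertexAdjacent : Rel Dart 0ℓ
  VertexAdjacent (x , _) (y , _) =
    ∃[ z ] IsDart z × SameVertex x z × SameVertex y (rev z)

  -- Faces are adjacent when they share an edge; rev z lies on the other side
  -- of the edge of z.
  FaceAdjacent : Rel Dart 0ℓ
  FaceAdjacent (f , _) (g , _) =
    ∃[ z ] IsDart z × SameFace f z × SameFace g (rev z)

  VertexOnFace : Ix → Ix → Set
  VertexOnFace x f = ∃[ z ] SameVertex x z × SameFace f z

  EdgeOnFace : Ix → Ix → Set
  EdgeOnFace x f = SameFace f x ⊎ SameFace f (rev x)

open EmbeddedGraph

private
  variable
    m n : ℕ

HasCardinality : Setoid 0ℓ 0ℓ → ℕ → Set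
HasCardinality S k = Bijection (≡.setoid (Fin k)) S

Connected : EmbeddedGraph n → Set
Connected M = ∀ ((x , _) (y , _) : Dart M) →
  EqClosure (λ a b → next M a ≡ b ⊎ rev M a ≡ b) x y

-- A rotation system always describes an orientable surface, and a connected
-- nonempty one describes the torus exactly when V - E + F = 0.
record OnTorus (M : EmbeddedGraph n) : Set where
  field
    nonempty  : Dart M
    connected : Connected M
    v e f     : ℕ
    #vertices : HasCardinality (Vertices M) v
    #edges    : HasCardinality (Edges M) e
    #faces    : HasCardinality (Faces M) f
    euler     : v + f ≡ e

record SimpleGraph (M : EmbeddedGraph n) : Set where
  field
    noLoops         : ∀ ((x , _) : Dart M) → ¬ SameVertex M x (rev M x)
    noMultipleEdges : ∀ ((x , _) (y , _) : Dart M) → SameVertex M x y →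
                      SameVertex M (rev M x) (rev M y) → x ≡ y

MinValence3 : EmbeddedGraph n → Set
MinValence3 M = ∀ ((x , _) : Dart M) → next M x ≢ x × next M (next M x) ≢ x

-- The closure of an (open disc) face is a closed disc, i.e. a closed 2-cell,
-- iff its boundary walk passes through no vertex twice.
ClosedTwoCellFaces : EmbeddedGraph n → Set
ClosedTwoCellFaces M = ∀ ((x , _) (y , _) : Dart M) →
  SameFace M x y → SameVertex M x y → x ≡ y

record IsMap (M : EmbeddedGraph n) : Set where
  field
    onTorus     : OnTorus M
    simple      : SimpleGraph M
    minValence3 : MinValence3 M
    closedCells : ClosedTwoCellFaces M

-- The intersection of two distinct closed faces is the union of their common
-- vertices and common edges; it is empty or connected iff any two common
-- vertices are joined by a path of common edges.  The condition holds
-- trivially when the two faces coincide, so distinctness is not required.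
MeetProperly : (M : EmbeddedGraph n) → Rel (Dart M) 0ℓ
MeetProperly M (f , _) (g , _) = ∀ ((x , _) (y , _) : Dart M) →
  VertexOnFace M x f → VertexOnFace M x g →
  VertexOnFace M y f → VertexOnFace M y g →
  EqClosure Step x y
  where
  Step : Rel (Ix M) 0ℓ
  Step a b = SameVertex M a b
           ⊎ (rev M a ≡ b × EdgeOnFace M a f × EdgeOnFace M a g)

record IsTPM (M : EmbeddedGraph n) : Set where
  field
    isMap        : IsMap M
    meetProperly : ∀ (f g : Dart M) → MeetProperly M f g

-- Remove d from its cycle: π⁻¹ d is sent to π d, and d becomes fixed.
excise : Fin n → Permutation′ n → Permutation′ n
excise d π = π ∘ₚ transpose d (π ⟨$⟩ʳ d)

module _ (d : Fin n) (π : Permutation′ n) where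

  excise-at : excise d π ⟨$⟩ʳ d ≡ d
  excise-at with π ⟨$⟩ʳ d ≟ d
  ... | yes p = p
  ... | no _ with π ⟨$⟩ʳ d ≟ π ⟨$⟩ʳ d
  ...   | yes _ = refl
  ...   | no ¬p = ⊥-elim (¬p refl)

  excise-fixed : ∀ x → π ⟨$⟩ʳ x ≡ x → excise d π ⟨$⟩ʳ x ≡ x
  excise-fixed x p with π ⟨$⟩ʳ x ≟ d
  ... | yes q = trans (cong (π ⟨$⟩ʳ_) (trans (sym q) p)) p
  ... | no _ with π ⟨$⟩ʳ x ≟ π ⟨$⟩ʳ d
  ...   | yes q = trans (sym (inverseˡ π))
                    (trans (cong (π ⟨$⟩ˡ_) (sym q)) (inverseˡ π))
  ...   | no _  = p

-- Delete the edge {d , rev d}, leaving all other rotations unchanged.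
delete : (M : EmbeddedGraph n) → Ix M → EmbeddedGraph n
delete M d = record
  { α            = α′
  ; σ            = σ′
  ; α-involutive = involutive
  ; σ-unused     = unused
  }
  where
  d′ : Ix M
  d′ = rev M d

  α′ σ′ : Permutation′ _
  α′ = excise d (α M)
  σ′ = excise d′ (excise d (σ M))

  α′-at-d′ : α′ ⟨$⟩ʳ d′ ≡ d′
  α′-at-d′ with rev M d′ ≟ d
  ... | yes _ = refl
  ... | no ¬p = ⊥-elim (¬p (α-involutive M d))

  α′-elsewhere : ∀ x → rev M x ≢ d → rev M x ≢ d′ → α′ ⟨$⟩ʳ x ≡ rev M x
  α′-elsewhere x p q with rev M x ≟ d
  ... | yes p′ = ⊥-elim (p p′)
  ... | no _ with rev M x ≟ d′
  ...   | yes q′ = ⊥-elim (q q′)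
  ...   | no _   = refl

  data Position (x : Ix M) : Set where
    at-d      : x ≡ d → Position x
    at-d′     : x ≡ d′ → Position x
    elsewhere : rev M x ≢ d → rev M x ≢ d′ → Position x

  position : ∀ x → Position x
  position x with rev M x ≟ d | rev M x ≟ d′
  ... | yes p | _     = at-d′ (trans (sym (α-involutive M x)) (cong (rev M) p))
  ... | no _  | yes q = at-d (trans (sym (α-involutive M x))
                          (trans (cong (rev M) q) (α-involutive M d)))
  ... | no p  | no q  = elsewhere p q

  involutive : ∀ x → α′ ⟨$⟩ʳ (α′ ⟨$⟩ʳ x) ≡ x
  involutive x with position x
  ... | at-d refl  = trans (cong (α′ ⟨$⟩ʳ_) (excise-at d (α M))) (excise-at d (α M))
  ... | at-d′ refl = trans (cong (α′ ⟨$⟩ʳ_) α′-at-d′) α′-at-d′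
  ... | elsewhere p q =
    trans (cong (α′ ⟨$⟩ʳ_) (α′-elsewhere x p q))
      (trans (α′-elsewhere (rev M x) p′ q′) (α-involutive M x))
    where
    p′ : rev M (rev M x) ≢ d
    p′ r = q (trans (sym (α-involutive M (rev M x))) (cong (rev M) r))
    q′ : rev M (rev M x) ≢ d′
    q′ r = p (trans (sym (α-involutive M (rev M x)))
               (trans (cong (rev M) r) (α-involutive M d)))

  unused : ∀ x → α′ ⟨$⟩ʳ x ≡ x → σ′ ⟨$⟩ʳ x ≡ x
  unused x e with position x
  ... | at-d refl  = excise-fixed d′ (excise d (σ M)) d (excise-at d (σ M))
  ... | at-d′ refl = excise-at d′ (excise d (σ M))
  ... | elsewhere p q =
    excise-fixed d′ (excise d (σ M)) x
      (excise-fixed d (σ M) x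
        (σ-unused M x (trans (sym (α′-elsewhere x p q)) e)))

-- The dual has the same darts, with the roles of vertices and faces exchanged:
-- next and along are interchanged.
dual : EmbeddedGraph n → EmbeddedGraph n
dual M = record
  { α            = α M
  ; σ            = α M ∘ₚ σ M
  ; α-involutive = α-involutive M
  ; σ-unused     = λ x e → trans (cong (next M) e) (σ-unused M x e)
  }

-- Contract the edge {d , rev d}.  Contracting an edge removes its two darts
-- from the boundary walks of its faces and leaves all other boundary walks
-- unchanged, so it is dual to deletion.  (For a loop this would instead split
-- its vertex, but it is only applied to edges that are not loops.)
contract : (M : EmbeddedGraph n) → Ix M → EmbeddedGraph n
contract M d = dual (delete (dual M) d)

TwoValent TwoSided : (M : EmbeddedGraph n) → Ix M → Set
TwoValent M x = next M x ≢ x × next M (next M x) ≡ x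
TwoSided M x  = along M x ≢ x × along M (along M x) ≡ x

twoValent? : ∀ (M : EmbeddedGraph n) x → Dec (TwoValent M x)
twoValent? M x = ¬? (next M x ≟ x) ×-dec (next M (next M x) ≟ x)

twoSided? : ∀ (M : EmbeddedGraph n) x → Dec (TwoSided M x)
twoSided? M x = ¬? (along M x ≟ x) ×-dec (along M (along M x) ≟ x)

-- If the vertex of x is 2-valent, coalesce its two edges into one; this is
-- the same as contracting one of the two.
coalesceVertex : (M : EmbeddedGraph n) → Ix M → EmbeddedGraph n
coalesceVertex M x = if does (twoValent? M x) then contract M x else M

-- If the face of x is two-sided, replace its two edges by a single edge; this
-- is the same as deleting one of the two.
collapseFace : (M : EmbeddedGraph n) → Ix M → EmbeddedGraph n
collapseFace M x = if does (twoSided? M x) then delete M x else M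

-- In a TPM, next d and next (rev d) are darts that survive the deletion of d
-- and represent its two end vertices.
removeEdge : (M : EmbeddedGraph n) → Ix M → EmbeddedGraph n
removeEdge M d =
  coalesceVertex (coalesceVertex (delete M d) (next M d)) (next M (rev M d))

-- In a TPM, along d and along (rev d) are darts that survive the contraction
-- of d and represent the two faces containing it.
shrinkEdge : (M : EmbeddedGraph n) → Ix M → EmbeddedGraph n
shrinkEdge M d =
  collapseFace (collapseFace (contract M d) (along M d)) (along M (rev M d))

Removable Shrinkable : (M : EmbeddedGraph n) → Dart M → Set
Removable M (d , _)  = IsTPM (removeEdge M d)
Shrinkable M (d , _) = IsTPM (shrinkEdge M d)

record Diminimal (M : EmbeddedGraph n) : Set where
  field
    isTPM          : IsTPM M
    noneRemovable  : ∀ (d : Dart M) → ¬ Removable M d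
    noneShrinkable : ∀ (d : Dart M) → ¬ Shrinkable M d

infix 4 _≅_

-- "Carries faces to faces": the image of the vertex set of a face f is the
-- vertex set of a face, faceMap f.
record _≅_ (M : EmbeddedGraph m) (N : EmbeddedGraph n) : Set where
  field
    vertexMap : Bijection (Vertices M) (Vertices N)
    faceMap   : Bijection (Faces M) (Faces N)

  open Bijection vertexMap public using () renaming (to to onVertex)
  open Bijection faceMap public using () renaming (to to onFace)

  field
    adjacency     : ∀ x y →
      VertexAdjacent M x y ⇔ VertexAdjacent N (onVertex x) (onVertex y)
    incidence     : ∀ x f →
      VertexOnFace M (proj₁ x) (proj₁ f) ⇔
      VertexOnFace N (proj₁ (onVertex x)) (proj₁ (onFace f))
    faceAdjacency : ∀ f g →
      FaceAdjacent M f g ⇔ FaceAdjacent N (onFace f) (onFace g)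

module Submission where

-- The 53 maps were found by a computer search and are given by their rotation
-- systems.  After removing or shrinking any edge of one of them, two faces have
-- two common vertices that no path of common edges joins; such faces are
-- exhibited by evaluating the operations on tables of darts that represent the
-- embedded graph.  The maps are told apart by Σ_x (Σ_{F ∋ x} |F|³)³, which
-- depends on the incidences of vertices x and faces F only.

open import Defs
open import Data.Bool.Base using (Bool; true; false; T; if_then_else_; not; _∧_; _∨_)
open import Data.Bool.ListAction using (all; and; any)
open import Data.Bool.Properties as 𝔹 using (T-∧; T-∨; T-≡)
open import Data.Empty using (⊥-elim)
open import Data.Fin.Base using (Fin; zero; suc; toℕ; fromℕ<)
open import Data.Fin.Permutation as Perm
  using (Permutation; Permutation′; permutation; _⟨$⟩ʳ_)
import Data.Fin.Permutation.Components as PC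
import Data.Fin.Properties as F
open import Data.List.Base
  using ( List; []; _∷_; _++_; map; foldr; iterate; length; lookup; tabulate
        ; upTo; applyUpTo; filter; filterᵇ; allFin)
open import Data.List.Membership.Propositional using (_∈_)
open import Data.List.Membership.Propositional.Properties
  using (∈-lookup; ∈-filter⁺; ∈-filter⁻; ∈-allFin)
open import Data.List.Properties using (≡-dec; map-tabulate; tabulate-cong)
open import Data.List.Relation.Unary.All as All using (All; []; _∷_)
import Data.List.Relation.Unary.All.Properties as All
open import Data.List.Relation.Unary.Any using (index)
import Data.List.Relation.Unary.Any.Properties as Any
open import Data.List.Relation.Unary.Unique.Propositional using (Unique; _∷_)
open import Data.List.Relation.Unary.Unique.Propositional.Properties using (filter⁺; allFin⁺)
open import Data.Nat.Base
  using (ℕ; zero; suc; pred; _+_; _*_; _^_; _≡ᵇ_; _<ᵇ_; _⊓_; _⊓′_; _<_)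
open import Data.Nat.Properties
  using ( _≟_; _<?_; +-0-commutativeMonoid; ≡ᵇ⇒≡; ≡⇒≡ᵇ; ⊓-comm; ⊓-sel
        ; +-identityʳ; +-suc)
open import Data.Product using (Σ-syntax; ∃-syntax; _×_; _,_; proj₁; proj₂)
open import Data.Sum.Base as Sum using (_⊎_; inj₁; inj₂)
open import Data.Vec.Base as Vec using (Vec)
import Data.Vec.Properties as Vec
import Data.Vec.Relation.Unary.All as VecAll
import Data.Vec.Relation.Unary.All.Properties as VecAll
open import Function.Base using (_∘_; id)
open import Function.Bundles using (Bijection; Equivalence; _⇔_; mk⇔)
import Function.Construct.Composition as Compose
open import Level using (0ℓ)
open import Relation.Binary.Bundles using (Setoid)
open import Relation.Binary.Construct.Closure.Equivalence as Eq using (EqClosure)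
open import Relation.Binary.Construct.Closure.ReflexiveTransitive using (ε; _◅_; _◅◅_)
open import Relation.Binary.Construct.Closure.Symmetric using (fwd; bwd)
import Relation.Binary.Construct.On as On
open import Relation.Binary.Core using (Rel)
open import Relation.Binary.PropositionalEquality as ≡
  using ( _≡_; _≢_; refl; sym; trans; cong; cong₂; subst; isEquivalence
        ; module ≡-Reasoning)
open import Relation.Nullary using (¬_; Dec; yes; no; does)
open import Relation.Nullary.Decidable using (map′; _×-dec_; _→-dec_; ¬?; T?; does-⇔)

open import Algebra.Properties.CommutativeMonoid.Sum +-0-commutativeMonoid
  using (sum; sum-permute; sum-cong-≗)

open EmbeddedGraph

-- The same labels refute some graphs and verify others, with different demands on them. A
-- refutation shows by actual walks along `next` and `along` that two faces share two vertices. The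
-- absence of a path of common edges follows from a Boolean invariant of such paths, for which
-- labels merely constant on orbits suffice; labels that are too coarse can only make the test fail.
-- Such labels survive deletion and contraction of any edge, so no orbit is recomputed after an
-- operation. Verifying the 53 maps also needs labels that separate orbits: there each label is the
-- index of a dart in its own orbit, which also yields the counts in Euler's formula. Everything is
-- settled by evaluation. The permutations that the operations build are nested compositions with
-- transpositions, evaluated anew at each dart; hence the lists of numbers. In the profile the outer
-- cube matters: Σ_x Σ_{F ∋ x} |F|³ equals Σ_F |F|⁴, which sees only the sizes of the faces and not
-- how they meet at vertices.

private
  variable
    A : Set
    n : ℕ

-- Boolean reflection

∧-T : ∀ a {b} → T (a ∧ b) → T a × T b
∧-T true t = _ , t

⇒-T : ∀ a {b} → T (not a ∨ b) → T a → T b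
⇒-T true t _ = t

and-T : ∀ bs → T (and bs) → All T bs
and-T []       _ = []
and-T (b ∷ bs) t with ∧-T b t
... | h , hs = h ∷ and-T bs hs

not-T : ∀ {a} → T (not a) → ¬ T a
not-T {false} _ ()

-- With `refl` as second argument only the Boolean part of the decision is evaluated, not the proof
-- inside it.
by-does : {P : Set} (P? : Dec P) → does P? ≡ true → P
by-does (yes p) _ = p

T-does : {P : Set} (P? : Dec P) → T (does P?) → P
T-does (yes p) _ = p

≢-T : ∀ {i j} → T (not (i ≡ᵇ j)) → i ≢ j
≢-T t = not-T t ∘ ≡⇒≡ᵇ _ _

-- The equation `xs ≡ tabulate f` separates the list that is evaluated from the function on `Fin n`
-- that is reasoned about.
any-T : ∀ (p : A → Bool) {xs} (f : Fin n → A) → xs ≡ tabulate f →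
        T (any p xs) → ∃[ x ] T (p (f x))
any-T p f refl = Any.tabulate⁻ ∘ Any.any⁻ p _

any-T⁺ : ∀ (p : A → Bool) {xs} (f : Fin n → A) → xs ≡ tabulate f →
         ∀ x → T (p (f x)) → T (any p xs)
any-T⁺ p f refl x = Any.any⁺ p ∘ Any.tabulate⁺ x

all-T : ∀ (p : A → Bool) {xs} (f : Fin n → A) → xs ≡ tabulate f →
        T (all p xs) → ∀ x → T (p (f x))
all-T p f refl = All.tabulate⁻ ∘ All.all⁺ p _

-- Filtering keeps the nested searches short; for reasoning it is traded for a conjunction over the
-- whole list, which has the form `tabulate f`.
any-filterᵇ : ∀ (p q : A → Bool) xs →
              T (any p (filterᵇ q xs)) → T (any (λ x → q x ∧ p x) xs)
any-filterᵇ p q (x ∷ xs) t with q x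
... | false = any-filterᵇ p q xs t
... | true with p x
...   | true  = _
...   | false = any-filterᵇ p q xs t

all-filterᵇ : ∀ (p q : A → Bool) xs →
              T (all p (filterᵇ q xs)) → T (all (λ x → not (q x) ∨ p x) xs)
all-filterᵇ p q []       t = _
all-filterᵇ p q (x ∷ xs) t with q x
... | false = all-filterᵇ p q xs t
... | true with p x
...   | true  = all-filterᵇ p q xs t

-- Tables

infixl 9 _!_

-- The default value 0 plays no role: all tables are read within range.
_!_ : List ℕ → ℕ → ℕ
[]      ! _     = 0
(x ∷ _) ! zero  = x
(_ ∷ t) ! suc i = t ! i

tabulate-! : ∀ {t} (f : Fin n → ℕ) → t ≡ tabulate f → ∀ x → t ! toℕ x ≡ f x
tabulate-! f refl zero    = refl
tabulate-! f refl (suc x) = tabulate-! (f ∘ suc) refl x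

map-tabulate′ : ∀ {xs} {f : Fin n → A} {B : Set} {g : A → B} {h : Fin n → B} →
                xs ≡ tabulate f → (∀ x → g (f x) ≡ h x) → map g xs ≡ tabulate h
map-tabulate′ {f = f} {g = g} refl e = trans (map-tabulate f g) (tabulate-cong e)

applyUpTo-tabulate : ∀ (f : ℕ → A) n → applyUpTo f n ≡ tabulate {n = n} (f ∘ toℕ)
applyUpTo-tabulate f zero    = refl
applyUpTo-tabulate f (suc n) = cong (f 0 ∷_) (applyUpTo-tabulate (f ∘ suc) n)

-- The last two tables label every dart with its vertex and with the face whose
-- boundary walk contains it.
record Tables : Set where
  constructor tables
  field
    revs nexts vertices faces : List ℕ
open Tables

infix 4 _⊨_

-- Labels have to be constant on orbits but may coincide on different orbits. This weak demand is
-- what every edge operation preserves unconditionally.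
record _⊨_ (T : Tables) (M : EmbeddedGraph n) : Set where
  field
    revs≡      : revs T ≡ tabulate (toℕ ∘ rev M)
    nexts≡     : nexts T ≡ tabulate (toℕ ∘ next M)
    vertexOf   : Ix M → ℕ
    faceOf     : Ix M → ℕ
    vertices≡  : vertices T ≡ tabulate vertexOf
    faces≡     : faces T ≡ tabulate faceOf
    vertex-inv : ∀ x → vertexOf (next M x) ≡ vertexOf x
    face-inv   : ∀ x → faceOf (along M x) ≡ faceOf x

  rev-! : ∀ x → revs T ! toℕ x ≡ toℕ (rev M x)
  rev-! = tabulate-! _ revs≡

  next-! : ∀ x → nexts T ! toℕ x ≡ toℕ (next M x)
  next-! = tabulate-! _ nexts≡

  along-! : ∀ x → nexts T ! (revs T ! toℕ x) ≡ toℕ (along M x)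
  along-! x = trans (cong (nexts T !_) (rev-! x)) (next-! (rev M x))
open _⊨_

-- Removing and shrinking edges on tables.

swap : ℕ → ℕ → ℕ → ℕ
swap i j k = if k ≡ᵇ i then j else if k ≡ᵇ j then i else k

exciseₜ : ℕ → List ℕ → List ℕ
exciseₜ d t = map (swap d (t ! d)) t

-- Deletion unites the faces on the two sides of an edge, so one label is renamed to the other. If
-- both sides carry the same label, nothing is renamed; the labels stay invariant even if the face
-- splits.
merge : ℕ → ℕ → ℕ → ℕ
merge a b l = if l ≡ᵇ a then b else l

deleteₜ : Tables → ℕ → Tables
deleteₜ (tables r s v f) d = tables
  (exciseₜ d r) (exciseₜ (r ! d) (exciseₜ d s))
  v (map (merge (f ! d) (f ! (r ! d))) f)

dualₜ : Tables → Tables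
dualₜ (tables r s v f) = tables r (map (s !_) r) f v

contractₜ : Tables → ℕ → Tables
contractₜ T d = dualₜ (deleteₜ (dualₜ T) d)

inTwoCycle : List ℕ → ℕ → Bool
inTwoCycle t x = not (t ! x ≡ᵇ x) ∧ (t ! (t ! x) ≡ᵇ x)

coalesceₜ collapseₜ removeₜ shrinkₜ : Tables → ℕ → Tables
coalesceₜ T x = if inTwoCycle (nexts T) x then contractₜ T x else T
collapseₜ T x = if inTwoCycle (nexts (dualₜ T)) x then deleteₜ T x else T
removeₜ T d =
  coalesceₜ (coalesceₜ (deleteₜ T d) (nexts T ! d)) (nexts T ! (revs T ! d))
shrinkₜ T d =
  collapseₜ (collapseₜ (contractₜ T d) (nexts T ! (revs T ! d)))
            -- This is `along M (rev M d)` with both reversals kept, so that the correctness proof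
            -- follows the definition literally.
            (nexts T ! (revs T ! (revs T ! d)))

does-≟ : ∀ (i j : Fin n) → does (i F.≟ j) ≡ (toℕ i ≡ᵇ toℕ j)
does-≟ zero    zero    = refl
does-≟ zero    (suc j) = refl
does-≟ (suc i) zero    = refl
does-≟ (suc i) (suc j) = does-≟ i j

swap-toℕ : ∀ (i j k : Fin n) → swap (toℕ i) (toℕ j) (toℕ k) ≡ toℕ (PC.transpose i j k)
swap-toℕ i j k rewrite sym (does-≟ k i) | sym (does-≟ k j)
  with does (k F.≟ i)
... | true = refl
... | false with does (k F.≟ j)
...   | true  = refl
...   | false = refl

-- Excision composes a permutation with one transposition, so a labelling survives it as soon as it
-- agrees at the two transposed indices.
transpose-inv : ∀ (ℓ : Fin n → ℕ) {i j} → ℓ i ≡ ℓ j →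
                ∀ k → ℓ (PC.transpose i j k) ≡ ℓ k
transpose-inv ℓ {i} {j} e k with k F.≟ i
... | yes refl = sym e
... | no _ with k F.≟ j
...   | yes refl = e
...   | no _     = refl

exciseₜ-≡ : ∀ {t} (d : Fin n) (π : Permutation′ n) → t ≡ tabulate (toℕ ∘ (π ⟨$⟩ʳ_)) →
            exciseₜ (toℕ d) t ≡ tabulate (toℕ ∘ (excise d π ⟨$⟩ʳ_))
exciseₜ-≡ d π e = map-tabulate′ e λ x →
  trans (cong (λ j → swap (toℕ d) j (toℕ (π ⟨$⟩ʳ x))) (tabulate-! _ e d))
        (swap-toℕ d (π ⟨$⟩ʳ d) (π ⟨$⟩ʳ x))

merge-left : ∀ a b → merge a b a ≡ b
merge-left a b rewrite Equivalence.to T-≡ (≡⇒≡ᵇ a a refl) = refl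

merge-right : ∀ a b → merge a b b ≡ b
merge-right a b = 𝔹.if-eta (b ≡ᵇ a)

dual-⊨ : ∀ {T} {M : EmbeddedGraph n} → T ⊨ M → dualₜ T ⊨ dual M
dual-⊨ {M = M} t = record
  { revs≡      = revs≡ t
  ; nexts≡     = map-tabulate′ (revs≡ t) (next-! t ∘ rev M)
  ; vertexOf   = faceOf t
  ; faceOf     = vertexOf t
  ; vertices≡  = faces≡ t
  ; faces≡     = vertices≡ t
  ; vertex-inv = face-inv t
  ; face-inv   = λ x → trans (cong (vertexOf t ∘ next M) (α-involutive M x)) (vertex-inv t x)
  }

-- Since `next M d` is `along M d′` and `next M d′` is `along M d`, the merged labelling agrees at
-- `d`, `d′` and their two successors. The three transpositions in the new `along` therefore do not
-- affect face labels.
delete-⊨ : ∀ {T} {M : EmbeddedGraph n} → T ⊨ M → ∀ d → deleteₜ T (toℕ d) ⊨ delete M d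
delete-⊨ {n = n} {T = tables r s v f} {M} t d = record
  { revs≡      = exciseₜ-≡ d (α M) (revs≡ t)
  ; nexts≡     = trans (cong (λ k → exciseₜ k (exciseₜ (toℕ d) s)) (rev-! t d))
                       (exciseₜ-≡ d′ (excise d (σ M)) (exciseₜ-≡ d (σ M) (nexts≡ t)))
  ; vertexOf   = vertexOf t
  ; faceOf     = ℓ
  ; vertices≡  = vertices≡ t
  ; faces≡     = map-tabulate′ (faces≡ t) λ x →
                   cong₂ (λ a b → merge a b (faceOf t x)) (tabulate-! _ (faces≡ t) d)
                     (trans (cong (f !_) (rev-! t d)) (tabulate-! _ (faces≡ t) d′))
  ; vertex-inv = excise-inv {vertexOf t} d′ (excise d (σ M))
                   (excise-inv {vertexOf t} d (σ M) (vertex-inv t))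
  ; face-inv   = λ x →
      trans (turn (PC.transpose d d′ (rev M x)))
        (trans (transpose-inv (ℓ ∘ next M) (trans ℓ-σd (sym ℓ-σd′)) (rev M x)) (ℓ-along x))
  }
  where
  d′ : Fin n
  d′ = rev M d

  ℓ : Fin n → ℕ
  ℓ x = merge (faceOf t d) (faceOf t d′) (faceOf t x)

  excise-inv : ∀ {ℓ : Fin n → ℕ} d (π : Permutation′ n) → (∀ x → ℓ (π ⟨$⟩ʳ x) ≡ ℓ x) →
               ∀ x → ℓ (excise d π ⟨$⟩ʳ x) ≡ ℓ x
  excise-inv {ℓ} d π e x = trans (transpose-inv ℓ (sym (e d)) (π ⟨$⟩ʳ x)) (e x)

  ℓ-along : ∀ x → ℓ (along M x) ≡ ℓ x
  ℓ-along x = cong (merge _ _) (face-inv t x)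

  ℓ-d : ℓ d ≡ ℓ d′
  ℓ-d = trans (merge-left (faceOf t d) _) (sym (merge-right (faceOf t d) _))

  ℓ-σd : ℓ (next M d) ≡ ℓ d
  ℓ-σd = trans (cong (ℓ ∘ next M) (sym (α-involutive M d))) (trans (ℓ-along d′) (sym ℓ-d))

  ℓ-σd′ : ℓ (next M d′) ≡ ℓ d
  ℓ-σd′ = ℓ-along d

  turn₁ : ∀ y → ℓ (excise d (σ M) ⟨$⟩ʳ y) ≡ ℓ (next M y)
  turn₁ y = transpose-inv ℓ (sym ℓ-σd) (next M y)

  turn : ∀ y → ℓ (excise d′ (excise d (σ M)) ⟨$⟩ʳ y) ≡ ℓ (next M y)
  turn y = trans
    (transpose-inv ℓ (trans (sym ℓ-d) (trans (sym ℓ-σd′) (sym (turn₁ d′))))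
      (excise d (σ M) ⟨$⟩ʳ y))
    (turn₁ y)

contract-⊨ : ∀ {T} {M : EmbeddedGraph n} → T ⊨ M → ∀ d → contractₜ T (toℕ d) ⊨ contract M d
contract-⊨ t d = dual-⊨ (delete-⊨ (dual-⊨ t) d)

inTwoCycle-does : ∀ t (π : Fin n → Fin n) → (∀ x → t ! toℕ x ≡ toℕ (π x)) → ∀ x →
  inTwoCycle t (toℕ x) ≡ not (does (π x F.≟ x)) ∧ does (π (π x) F.≟ x)
inTwoCycle-does t π e x
  rewrite e x | e (π x) | does-≟ (π x) x | does-≟ (π (π x)) x = refl

if-⊨ : ∀ {b c T U} {M N : EmbeddedGraph n} → b ≡ c → T ⊨ M → U ⊨ N →
       (if b then T else U) ⊨ (if c then M else N)
if-⊨ {b = true}  refl t u = t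
if-⊨ {b = false} refl t u = u

coalesce-⊨ : ∀ {T} {M : EmbeddedGraph n} → T ⊨ M → ∀ k x → k ≡ toℕ x →
             coalesceₜ T k ⊨ coalesceVertex M x
coalesce-⊨ {T = T} {M} t _ x refl =
  if-⊨ (inTwoCycle-does (nexts T) (next M) (next-! t) x) (contract-⊨ t x) t

collapse-⊨ : ∀ {T} {M : EmbeddedGraph n} → T ⊨ M → ∀ k x → k ≡ toℕ x →
             collapseₜ T k ⊨ collapseFace M x
collapse-⊨ {T = T} {M} t _ x refl =
  if-⊨ (inTwoCycle-does (nexts (dualₜ T)) (along M) (next-! (dual-⊨ t)) x) (delete-⊨ t x) t

remove-⊨ : ∀ {T} {M : EmbeddedGraph n} → T ⊨ M → ∀ d → removeₜ T (toℕ d) ⊨ removeEdge M d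
remove-⊨ {T = T} {M} t d =
  coalesce-⊨ {M = coalesceVertex (delete M d) (next M d)}
    (coalesce-⊨ {M = delete M d} (delete-⊨ t d) (nexts T ! toℕ d) (next M d) (next-! t d))
    (nexts T ! (revs T ! toℕ d)) (next M (rev M d)) (along-! t d)

shrink-⊨ : ∀ {T} {M : EmbeddedGraph n} → T ⊨ M → ∀ d → shrinkₜ T (toℕ d) ⊨ shrinkEdge M d
shrink-⊨ {T = T} {M} t d =
  collapse-⊨ {M = collapseFace (contract M d) (along M d)}
    (collapse-⊨ {M = contract M d} (contract-⊨ t d) _ (along M d) (along-! t d))
    _ (along M (rev M d))
    (trans (cong (λ k → nexts T ! (revs T ! k)) (rev-! t d)) (along-! t (rev M d)))

-- Corners

-- The primed fields belong to the reversed dart.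
record Corner : Set where
  constructor corner
  field
    dart vertex face vertex′ face′ : ℕ
open Corner

module _ (v f : List ℕ) where

  cornersFrom : ℕ → List ℕ → List ℕ → List ℕ → List Corner
  cornersFrom k (x ∷ r) (a ∷ v′) (b ∷ f′) =
    corner k a b (v ! x) (f ! x) ∷ cornersFrom (suc k) r v′ f′
  cornersFrom _ _ _ _ = []

  cornersFrom-tabulate : ∀ k {n} (g a b : Fin n → ℕ) →
    cornersFrom k (tabulate g) (tabulate a) (tabulate b) ≡
    tabulate (λ x → corner (k + toℕ x) (a x) (b x) (v ! g x) (f ! g x))
  cornersFrom-tabulate k {zero}  g a b = refl
  cornersFrom-tabulate k {suc n} g a b = cong₂ _∷_
    (cong (at zero) (sym (+-identityʳ k)))
    (trans (cornersFrom-tabulate (suc k) (g ∘ suc) (a ∘ suc) (b ∘ suc))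
      (tabulate-cong λ x → cong (at (suc x)) (sym (+-suc k (toℕ x)))))
    where
    at : Fin (suc n) → ℕ → Corner
    at x i = corner i (a x) (b x) (v ! g x) (f ! g x)

corners : Tables → List Corner
corners (tables r s v f) = cornersFrom v f 0 r v f

cornerAt : ∀ {T} {M : EmbeddedGraph n} → T ⊨ M → Ix M → Corner
cornerAt {M = M} t x =
  corner (toℕ x) (vertexOf t x) (faceOf t x) (vertexOf t (rev M x)) (faceOf t (rev M x))

corners≡ : ∀ {T} {M : EmbeddedGraph n} (t : T ⊨ M) → corners T ≡ tabulate (cornerAt t)
corners≡ {T = tables r s v f} {M} t = begin
  cornersFrom v f 0 r v f
    ≡⟨ cong (λ r′ → cornersFrom v f 0 r′ v f) (revs≡ t) ⟩
  cornersFrom v f 0 (tabulate (toℕ ∘ rev M)) v f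
    ≡⟨ cong₂ (cornersFrom v f 0 _) (vertices≡ t) (faces≡ t) ⟩
  cornersFrom v f 0 (tabulate (toℕ ∘ rev M)) (tabulate (vertexOf t)) (tabulate (faceOf t))
    ≡⟨ cornersFrom-tabulate v f 0 _ _ _ ⟩
  tabulate (λ x → corner (toℕ x) (vertexOf t x) (faceOf t x)
                         (v ! toℕ (rev M x)) (f ! toℕ (rev M x)))
    ≡⟨ tabulate-cong (λ x → cong₂ (corner _ _ _)
         (tabulate-! _ (vertices≡ t) (rev M x)) (tabulate-! _ (faces≡ t) (rev M x))) ⟩
  tabulate (cornerAt t) ∎
  where open ≡-Reasoning

sameVertex⇒≡ : ∀ {T} {M : EmbeddedGraph n} (t : T ⊨ M) {x y} →
               SameVertex M x y → vertexOf t x ≡ vertexOf t y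
sameVertex⇒≡ t = Eq.gfold isEquivalence (vertexOf t) λ { {x} refl → sym (vertex-inv t x) }

sameFace⇒≡ : ∀ {T} {M : EmbeddedGraph n} (t : T ⊨ M) {x y} →
             SameFace M x y → faceOf t x ≡ faceOf t y
sameFace⇒≡ t = Eq.gfold isEquivalence (faceOf t) λ { {x} refl → sym (face-inv t x) }

reaches : (ℕ → ℕ) → ℕ → ℕ → ℕ → Bool
reaches g zero    z y = z ≡ᵇ y
reaches g (suc k) z y = (z ≡ᵇ y) ∨ reaches g k (g z) y

-- The target is a number rather than an element of `Fin n`: a label read from a table, or the base
-- dart 0, is known to be an index only because the walk arrives there.
reaches-sound : ∀ g (p : Fin n → Fin n) → (∀ x → g (toℕ x) ≡ toℕ (p x)) →
  ∀ k x {y} → T (reaches g k (toℕ x) y) →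
  ∃[ w ] toℕ w ≡ y × EqClosure (λ a b → p a ≡ b) x w
reaches-sound g p e zero    x h = x , ≡ᵇ⇒≡ _ _ h , ε
reaches-sound g p e (suc k) x {y} h with Equivalence.to T-∨ h
... | inj₁ h₀ = x , ≡ᵇ⇒≡ _ _ h₀ , ε
... | inj₂ h₁ with reaches-sound g p e k (p x) (subst (λ z → T (reaches g k z y)) (e x) h₁)
...   | w , q , path = w , q , fwd refl ◅ path

reaches-toℕ : ∀ g (p : Fin n → Fin n) → (∀ x → g (toℕ x) ≡ toℕ (p x)) →
  ∀ k x y → T (reaches g k (toℕ x) (toℕ y)) → EqClosure (λ a b → p a ≡ b) x y
reaches-toℕ g p e k x y h with reaches-sound g p e k x h
... | w , q , path rewrite F.toℕ-injective q = path

among : ℕ → ℕ → ℕ → Bool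
among a b l = (l ≡ᵇ a) ∨ (l ≡ᵇ b)

onBoth : Corner → Corner → Corner → Bool
onBoth x y c = among (face c) (face′ c) (face x) ∧ among (face c) (face′ c) (face y)

-- This supplies the candidate for `b` in `separation`: the component of the intersection at this
-- vertex is guessed to be a single vertex (the default) or a single edge. A wrong guess is
-- harmless, because closure under common edges is checked there.
otherEnd : Corner → Corner → List Corner → ℕ
otherEnd x y []      = vertex x
otherEnd x y (c ∷ C) =
  if (vertex c ≡ᵇ vertex x) ∧ onBoth x y c then vertex′ c else otherEnd x y C

-- x₁, y₁ lie on one face, x₂, y₂ on another, and both faces contain the vertex
-- of x₁, x₂ and that of y₁, y₂.  The vertex of x₁ and b, which may coincide, are
-- closed under the common edges of the two faces and do not include that of y₁.
separation : Tables → (C : List Corner) (x₁ x₂ y₁ y₂ : Corner) → ℕ → List Bool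
separation (tables r s _ _) C x₁ x₂ y₁ y₂ b =
  not (inside (vertex y₁)) ∷
  all (λ c → not (onBoth x₁ x₂ c) ∨ does (inside (vertex c) 𝔹.≟ inside (vertex′ c))) C ∷
  live x₁ ∷ live x₂ ∷ live y₁ ∷
  turns x₁ x₂ ∷ turns y₁ y₂ ∷ walks x₁ y₁ ∷ walks x₂ y₂ ∷ []
  where
  inside : ℕ → Bool
  inside = among (vertex x₁) b
  live : Corner → Bool
  live x = not (r ! dart x ≡ᵇ dart x)
  turns walks : Corner → Corner → Bool
  turns x y = reaches (s !_) (length r) (dart x) (dart y)
  walks x y = reaches (λ z → s ! (r ! z)) (length r) (dart x) (dart y)

cornersOfFace cornersOfVertex : List Corner → Corner → List Corner
cornersOfFace   C x = filterᵇ (λ c → face c ≡ᵇ face x) C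
cornersOfVertex C x = filterᵇ (λ c → vertex c ≡ᵇ vertex x) C

-- Shared subterms are passed as arguments because evaluation shares these only.
improperAt : Tables → List Corner → Corner → Bool
improperAt T C x₁ = search (cornersOfFace C x₁)
  where
  search : List Corner → Bool
  search F₁ = any
    (λ x₂ → not (face x₁ ≡ᵇ face x₂) ∧ pairs x₂ (cornersOfFace C x₂) (otherEnd x₁ x₂ C))
    (cornersOfVertex C x₁)
    where
    pairs : Corner → List Corner → ℕ → Bool
    pairs x₂ F₂ b = any (λ y₁ → any (λ y₂ →
      (vertex y₁ ≡ᵇ vertex y₂) ∧ not (vertex x₁ ≡ᵇ vertex y₁) ∧
      and (separation T C x₁ x₂ y₁ y₂ b)) F₂) F₁

improper : (Corner → Bool) → Tables → Bool
improper p T = search (corners T)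
  where
  search : List Corner → Bool
  search C = any (improperAt T C) (filterᵇ p C)

-- Improper meetings refute polyhedrality.

module _ {U : Tables} {M : EmbeddedGraph n} (u : U ⊨ M) where

  private
    at : Ix M → Corner
    at = cornerAt u

  any-corners : ∀ {p} → T (any p (corners U)) → ∃[ x ] T (p (at x))
  any-corners {p} = any-T p at (corners≡ u)

  any-corners-filterᵇ : ∀ p q → T (any p (filterᵇ q (corners U))) → ∃[ x ] T (p (at x))
  any-corners-filterᵇ p q h with any-corners (any-filterᵇ p q (corners U) h)
  ... | x , h′ = x , proj₂ (∧-T (q (at x)) h′)

  edgeOnFace⇒among : ∀ {f z} → EdgeOnFace M z f →
    T (among (faceOf u z) (faceOf u (rev M z)) (faceOf u f))
  edgeOnFace⇒among (inj₁ p) = Equivalence.from T-∨ (inj₁ (≡⇒≡ᵇ _ _ (sameFace⇒≡ u p)))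
  edgeOnFace⇒among (inj₂ p) = Equivalence.from T-∨ (inj₂ (≡⇒≡ᵇ _ _ (sameFace⇒≡ u p)))

  -- `inside` is an invariant of the steps allowed in `MeetProperly`: turning at a vertex keeps the
  -- vertex label, and the closure check covers common edges. Labels may show more common edges than
  -- there are, which only strengthens that check. A path from `x₁` to `y₁` would carry `inside` to
  -- a vertex that is outside.
  separated⇒¬tpm : ∀ x₁ x₂ y₁ y₂ b →
    T (and (separation U (corners U) (at x₁) (at x₂) (at y₁) (at y₂) b)) → ¬ IsTPM M
  separated⇒¬tpm x₁ x₂ y₁ y₂ b h tpm
    with and-T (separation U (corners U) (at x₁) (at x₂) (at y₁) (at y₂) b) h
  ... | y₁-outside ∷ closed ∷ live-x₁ ∷ live-x₂ ∷ live-y₁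
      ∷ turn-x ∷ turn-y ∷ walk₁ ∷ walk₂ ∷ [] =
    not-T y₁-outside (subst T (Eq.gfold isEquivalence inside step path)
      (Equivalence.from T-∨ (inj₁ (≡⇒≡ᵇ (vertexOf u x₁) _ refl))))
    where
    inside : Ix M → Bool
    inside z = among (vertexOf u x₁) b (vertexOf u z)

    dart! : ∀ x → T (not (revs U ! toℕ x ≡ᵇ toℕ x)) → IsDart M x
    dart! x l e = ≢-T l (trans (rev-! u x) (cong toℕ e))

    turn : ∀ x y → T (reaches (nexts U !_) (length (revs U)) (toℕ x) (toℕ y)) →
           SameVertex M x y
    turn = reaches-toℕ _ (next M) (next-! u) (length (revs U))

    walk : ∀ x y →
           T (reaches (λ z → nexts U ! (revs U ! z)) (length (revs U)) (toℕ x) (toℕ y)) →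
           SameFace M x y
    walk = reaches-toℕ _ (along M) (along-! u) (length (revs U))

    -- `x₁` stands both for the first face and for the first common vertex; `x₂` stands for the
    -- second face and `y₁` for the second common vertex.
    path = IsTPM.meetProperly tpm
      (x₁ , dart! x₁ live-x₁) (x₂ , dart! x₂ live-x₂)
      (x₁ , dart! x₁ live-x₁) (y₁ , dart! y₁ live-y₁)
      (x₁ , ε , ε)
      (x₂ , turn x₁ x₂ turn-x , ε)
      (y₁ , ε , walk x₁ y₁ walk₁)
      (y₂ , turn y₁ y₂ turn-y , walk x₂ y₂ walk₂)

    step : ∀ {z w} →
           SameVertex M z w ⊎ (rev M z ≡ w × EdgeOnFace M z x₁ × EdgeOnFace M z x₂) →
           inside z ≡ inside w
    step (inj₁ p) = cong (among (vertexOf u x₁) b) (sameVertex⇒≡ u p)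
    step {z} (inj₂ (refl , p , q)) = T-does (_ 𝔹.≟ _)
      (⇒-T (onBoth (at x₁) (at x₂) (at z)) (all-T _ at (corners≡ u) closed z)
        (Equivalence.from T-∧ (edgeOnFace⇒among p , edgeOnFace⇒among q)))

  -- Any `p` is sound, since it only narrows the range of corners at which the search starts.
  improper⇒¬tpm : ∀ p → T (improper p U) → ¬ IsTPM M
  improper⇒¬tpm p h with any-corners-filterᵇ _ p h
  ... | x₁ , h with any-corners-filterᵇ _ _ h
  ... | x₂ , h with any-corners-filterᵇ _ _ (proj₂ (∧-T (not (faceOf u x₁ ≡ᵇ faceOf u x₂)) h))
  ... | y₁ , h with any-corners-filterᵇ _ _ h
  ... | y₂ , h = separated⇒¬tpm x₁ x₂ y₁ y₂ _
    (proj₂ (∧-T (not (vertexOf u x₁ ≡ᵇ vertexOf u y₁))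
      (proj₂ (∧-T (vertexOf u y₁ ≡ᵇ vertexOf u y₂) h))))

-- Orbits

Orbit : (Fin n → Fin n) → Rel (Fin n) 0ℓ
Orbit p = EqClosure (λ x y → p x ≡ y)

-- When each label is an index in its own orbit, every orbit contains exactly one index that equals
-- its label.
roots : (Fin n → ℕ) → List (Fin n)
roots {n} ℓ = filter (λ x → ℓ x ≟ toℕ x) (allFin n)

lookup-injective : ∀ {xs : List A} → Unique xs → ∀ i j → lookup xs i ≡ lookup xs j → i ≡ j
lookup-injective (_ ∷ _)  zero    zero    _ = refl
lookup-injective (x∉ ∷ _) zero    (suc j) e = ⊥-elim (All.lookup x∉ (∈-lookup j) e)
lookup-injective (x∉ ∷ _) (suc i) zero    e = ⊥-elim (All.lookup x∉ (∈-lookup i) (sym e))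
lookup-injective (_ ∷ xs) (suc i) (suc j) e = cong suc (lookup-injective xs i j e)

-- `inv` makes labels constant on orbits; `rooted` gives the converse, since two indices with one
-- label are both joined to the index that the label names.
module Orbits (p : Fin n → Fin n) (ℓ : Fin n → ℕ) (inv : ∀ x → ℓ (p x) ≡ ℓ x)
              (rooted : ∀ x → ∃[ w ] toℕ w ≡ ℓ x × Orbit p x w) where

  orbit⇒≡ : ∀ {x y} → Orbit p x y → ℓ x ≡ ℓ y
  orbit⇒≡ = Eq.gfold isEquivalence ℓ λ { {x} refl → sym (inv x) }

  ≡⇒orbit : ∀ x y → ℓ x ≡ ℓ y → Orbit p x y
  ≡⇒orbit x y e with rooted x | rooted y
  ... | w , qx , px | w′ , qy , py
    rewrite F.toℕ-injective (trans qx (trans e (sym qy))) = px ◅◅ Eq.symmetric _ py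

  ℓ-root : ∀ i → ℓ (lookup (roots ℓ) i) ≡ toℕ (lookup (roots ℓ) i)
  ℓ-root i = proj₂ (∈-filter⁻ (λ x → ℓ x ≟ toℕ x) {xs = allFin n} (∈-lookup i))

  cardinality : {P : Fin n → Set} (P-all : ∀ x → P x) →
    HasCardinality (On.setoid (Eq.setoid (λ x y → p x ≡ y)) (proj₁ {B = P})) (length (roots ℓ))
  cardinality P-all = record
    { to        = λ i → lookup (roots ℓ) i , P-all _
    ; cong      = λ { refl → ε }
    ; bijective =
        (λ {i} {j} o → lookup-injective (filter⁺ (λ x → ℓ x ≟ toℕ x) (allFin⁺ n)) i j
          (F.toℕ-injective (trans (sym (ℓ-root i)) (trans (orbit⇒≡ o) (ℓ-root j)))))
      , λ (x , _) → onto x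
    }
    where
    onto : ∀ x → ∃[ i ] (∀ {j} → j ≡ i → Orbit p (lookup (roots ℓ) j) x)
    onto x with rooted x
    ... | w , q , o = index w∈ ,
      λ { refl → subst (λ z → Orbit p z x) (Any.lookup-index w∈) (Eq.symmetric _ o) }
      where
      w∈ : w ∈ roots ℓ
      w∈ = ∈-filter⁺ (λ x → ℓ x ≟ toℕ x) (∈-allFin w) (trans (sym (orbit⇒≡ o)) (sym q))

-- Polyhedral maps

-- Two common vertices of distinct faces have to be equal or joined by a single common edge. Longer
-- paths need not be searched: the vertex between two consecutive edges common to two faces would be
-- 2-valent.
properAt : List Corner → Corner → Bool
properAt C x₁ = search (cornersOfFace C x₁)
  where
  search : List Corner → Bool
  search F₁ = all (λ x₂ → (face x₁ ≡ᵇ face x₂) ∨ pairs x₂ (cornersOfFace C x₂))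
                  (cornersOfVertex C x₁)
    where
    pairs : Corner → List Corner → Bool
    pairs x₂ F₂ = all (λ y₁ → all (λ y₂ → not (vertex y₁ ≡ᵇ vertex y₂) ∨
      (vertex x₁ ≡ᵇ vertex y₁) ∨
      any (λ c → (vertex c ≡ᵇ vertex x₁) ∧ (vertex′ c ≡ᵇ vertex y₁) ∧ onBoth x₁ x₂ c) C) F₂) F₁

-- Iterating this leads to dart 0, because in the maps below every vertex but
-- the first has a neighbour of smaller label.
descend : Tables → ℕ → ℕ
descend (tables r s v _) z = if v ! (r ! z) <ᵇ v ! z then r ! z else s ! z

polyhedral : Tables → List Corner → List Bool
polyhedral U C =
  all (λ c → not (vertex c ≡ᵇ vertex′ c)) C ∷
  -- Two different darts at one vertex with the same other end would give a multiple edge; with the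
  -- same face they would make its boundary pass the vertex twice. One test excludes both.
  all (λ c → all (λ d → not (vertex c ≡ᵇ vertex d) ∨
    not ((vertex′ c ≡ᵇ vertex′ d) ∨ (face c ≡ᵇ face d)) ∨ (dart c ≡ᵇ dart d)) C) C ∷
  all (λ c → not (nexts U ! dart c ≡ᵇ dart c)) C ∷
  all (λ c → not (nexts U ! (nexts U ! dart c) ≡ᵇ dart c)) C ∷
  all (properAt C) C ∷
  all (λ c → reaches (descend U) (length (revs U)) (dart c) 0) C ∷ []

module Polyhedral {U : Tables} {M : EmbeddedGraph n} (u : U ⊨ M)
  (isDart : ∀ x → IsDart M x)
  (v-rooted : ∀ x → ∃[ w ] toℕ w ≡ vertexOf u x × SameVertex M x w)
  (f-rooted : ∀ x → ∃[ w ] toℕ w ≡ faceOf u x × SameFace M x w)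
  where

  private
    at : Ix M → Corner
    at = cornerAt u

    edgeOf : Ix M → ℕ
    edgeOf x = toℕ x ⊓ toℕ (rev M x)

    e-inv : ∀ x → edgeOf (rev M x) ≡ edgeOf x
    e-inv x = trans (cong (λ y → toℕ (rev M x) ⊓ toℕ y) (α-involutive M x))
                    (⊓-comm (toℕ (rev M x)) _)

    e-rooted : ∀ x → ∃[ w ] toℕ w ≡ edgeOf x × Orbit (rev M) x w
    e-rooted x with ⊓-sel (toℕ x) (toℕ (rev M x))
    ... | inj₁ q = x , sym q , ε
    ... | inj₂ q = rev M x , sym q , fwd refl ◅ ε

  module V = Orbits (next M) (vertexOf u) (vertex-inv u) v-rooted
  module E = Orbits (rev M) edgeOf e-inv e-rooted
  module F′ = Orbits (along M) (faceOf u) (face-inv u) f-rooted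

  all-corners : ∀ {p} → T (all p (corners U)) → ∀ x → T (p (at x))
  all-corners {p} = all-T p at (corners≡ u)

  all-corners-filterᵇ : ∀ p q → T (all p (filterᵇ q (corners U))) →
                        ∀ x → T (q (at x)) → T (p (at x))
  all-corners-filterᵇ p q h x = ⇒-T (q (at x)) (all-corners (all-filterᵇ p q (corners U) h) x)

  -- This settles the case of two darts on the same face, whose boundary walk is itself a path of
  -- common edges: `along` crosses an edge and then turns at its end. `R` abstracts from the step
  -- relation, which is local to `MeetProperly`.
  face-walk : ∀ {R : Rel (Ix M) 0ℓ} {f} →
    (∀ {a b} → SameVertex M a b → R a b) → (∀ {a} → SameFace M f a → R a (rev M a)) →
    ∀ {z w} → SameFace M f z → SameFace M z w → EqClosure R z w
  face-walk vert edge o ε = ε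
  face-walk vert edge o (fwd refl ◅ p) =
    fwd (edge o) ◅ fwd (vert (fwd refl ◅ ε)) ◅ face-walk vert edge (o ◅◅ fwd refl ◅ ε) p
  face-walk vert edge o (bwd refl ◅ p) =
    bwd (vert (fwd refl ◅ ε)) ◅ bwd (edge o′) ◅ face-walk vert edge o′ p
    where o′ = o ◅◅ bwd refl ◅ ε

  among⇒edgeOnFace : ∀ {f z w} → SameFace M f w →
    T (among (faceOf u z) (faceOf u (rev M z)) (faceOf u w)) → EdgeOnFace M z f
  among⇒edgeOnFace o h = Sum.map (onFace _) (onFace _) (Equivalence.to T-∨ h)
    where
    onFace : ∀ y → T (faceOf u _ ≡ᵇ faceOf u y) → SameFace M _ y
    onFace y e = o ◅◅ F′.≡⇒orbit _ y (≡ᵇ⇒≡ _ _ e)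

  module _ (checks : All T (polyhedral U (corners U))) where

    private
      loopless = All.head checks
      unique   = All.head (All.tail checks)
      valence₁ = All.head (All.tail (All.tail checks))
      valence₂ = All.head (All.tail (All.tail (All.tail checks)))
      meets    = All.head (All.tail (All.tail (All.tail (All.tail checks))))
      links    = All.head (All.tail (All.tail (All.tail (All.tail (All.tail checks)))))

    proper : ∀ x₁ x₂ y₁ y₂ → faceOf u x₁ ≢ faceOf u x₂ → vertexOf u x₂ ≡ vertexOf u x₁ →
      faceOf u y₁ ≡ faceOf u x₁ → faceOf u y₂ ≡ faceOf u x₂ → vertexOf u y₁ ≡ vertexOf u y₂ →
      vertexOf u x₁ ≡ vertexOf u y₁ ⊎
      (∃[ z ] vertexOf u z ≡ vertexOf u x₁ × vertexOf u (rev M z) ≡ vertexOf u y₁ ×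
              T (onBoth (at x₁) (at x₂) (at z)))
    proper x₁ x₂ y₁ y₂ f≢ v₂ f₁ f₂ v
      with Equivalence.to T-∨ (all-corners-filterᵇ _ _ (all-corners meets x₁) x₂ (≡⇒≡ᵇ _ _ v₂))
    ... | inj₁ e = ⊥-elim (f≢ (≡ᵇ⇒≡ _ _ e))
    ... | inj₂ h
      with Equivalence.to T-∨ (⇒-T (vertexOf u y₁ ≡ᵇ vertexOf u y₂)
             (all-corners-filterᵇ _ _ (all-corners-filterᵇ _ _ h y₁ (≡⇒≡ᵇ _ _ f₁)) y₂ (≡⇒≡ᵇ _ _ f₂))
             (≡⇒≡ᵇ _ _ v))
    ... | inj₁ e = inj₁ (≡ᵇ⇒≡ _ _ e)
    ... | inj₂ h with any-corners u h
    ... | z , h with ∧-T (vertexOf u z ≡ᵇ vertexOf u x₁) h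
    ... | a , h with ∧-T (vertexOf u (rev M z) ≡ᵇ vertexOf u y₁) h
    ... | b , h = inj₂ (z , ≡ᵇ⇒≡ _ _ a , ≡ᵇ⇒≡ _ _ b , h)

    meetProperly : ∀ f g → MeetProperly M f g
    meetProperly f g x y (z₁ , xz₁ , fz₁) (z₂ , xz₂ , gz₂) (z₃ , yz₃ , fz₃) (z₄ , yz₄ , gz₄)
      with faceOf u z₁ ≟ faceOf u z₂
    ... | yes e =
      fwd (inj₁ xz₁) ◅
      face-walk inj₁ (λ o → inj₂ (refl , inj₁ o , inj₁ (gf ◅◅ o))) fz₁
        (Eq.symmetric _ fz₁ ◅◅ fz₃)
      ◅◅ bwd (inj₁ yz₃) ◅ ε
      where gf = gz₂ ◅◅ F′.≡⇒orbit z₂ z₁ (sym e) ◅◅ Eq.symmetric _ fz₁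
    ... | no f≢ with proper z₁ z₂ z₃ z₄ f≢
                       (V.orbit⇒≡ (Eq.symmetric _ xz₂ ◅◅ xz₁))
                       (F′.orbit⇒≡ (Eq.symmetric _ fz₃ ◅◅ fz₁))
                       (F′.orbit⇒≡ (Eq.symmetric _ gz₄ ◅◅ gz₂))
                       (V.orbit⇒≡ (Eq.symmetric _ yz₃ ◅◅ yz₄))
    ... | inj₁ v = fwd (inj₁ (xz₁ ◅◅ V.≡⇒orbit z₁ z₃ v ◅◅ Eq.symmetric _ yz₃)) ◅ ε
    ... | inj₂ (z , v₁ , v₂ , h) with ∧-T (among (faceOf u z) (faceOf u (rev M z)) (faceOf u z₁)) h
    ... | zf , zg =
      fwd (inj₁ (xz₁ ◅◅ V.≡⇒orbit z₁ z (sym v₁))) ◅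
      fwd (inj₂ (refl , among⇒edgeOnFace fz₁ zf , among⇒edgeOnFace gz₂ zg)) ◅
      fwd (inj₁ (V.≡⇒orbit (rev M z) z₃ v₂ ◅◅ Eq.symmetric _ yz₃)) ◅ ε

    corner-unique : ∀ x y → vertexOf u x ≡ vertexOf u y →
      vertexOf u (rev M x) ≡ vertexOf u (rev M y) ⊎ faceOf u x ≡ faceOf u y → x ≡ y
    corner-unique x y v h = F.toℕ-injective (≡ᵇ⇒≡ _ _
      (⇒-T ((vertexOf u (rev M x) ≡ᵇ vertexOf u (rev M y)) ∨ (faceOf u x ≡ᵇ faceOf u y))
        (⇒-T (vertexOf u x ≡ᵇ vertexOf u y) (all-corners (all-corners unique x) y) (≡⇒≡ᵇ _ _ v))
        (Equivalence.from T-∨ (Sum.map (≡⇒≡ᵇ _ _) (≡⇒≡ᵇ _ _) h))))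

    step : Ix M → Ix M
    step x = if vertexOf u (rev M x) <ᵇ vertexOf u x then rev M x else next M x

    descend-step : ∀ x → descend U (toℕ x) ≡ toℕ (step x)
    descend-step x
      rewrite rev-! u x | next-! u x
            | tabulate-! _ (vertices≡ u) (rev M x) | tabulate-! _ (vertices≡ u) x =
      sym (𝔹.if-float toℕ (vertexOf u (rev M x) <ᵇ vertexOf u x))

    Linked : Rel (Ix M) 0ℓ
    Linked = EqClosure (λ a b → next M a ≡ b ⊎ rev M a ≡ b)

    step-linked : ∀ {x y} → step x ≡ y → Linked x y
    step-linked {x} refl with vertexOf u (rev M x) <ᵇ vertexOf u x
    ... | true  = fwd (inj₂ refl) ◅ ε
    ... | false = fwd (inj₁ refl) ◅ ε

    -- Each value of `step` is a reversal or a turn, so connectedness follows once evaluation shows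
    -- that every dart is led to dart 0.
    toBase : ∀ x → ∃[ w ] toℕ w ≡ 0 × Linked x w
    toBase x
      with reaches-sound _ step descend-step (length (revs U)) x (all-corners links x)
    ... | w , w≡0 , path = w , w≡0 , (step-linked Eq.⋆) path

    connected : Connected M
    connected (x , _) (y , _) with toBase x | toBase y
    ... | w , qx , px | w′ , qy , py rewrite F.toℕ-injective (trans qx (sym qy)) =
      px ◅◅ Eq.symmetric _ py

    isMap : Ix M →
      length (roots (vertexOf u)) + length (roots (faceOf u)) ≡ length (roots edgeOf) →
      IsMap M
    isMap x euler = record
      { onTorus = record
        { nonempty  = x , isDart x
        ; connected = connected
        ; #vertices = V.cardinality isDart
        ; #edges    = E.cardinality isDart
        ; #faces    = F′.cardinality isDart
        ; euler     = euler
        }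
      ; simple = record
        { noLoops         = λ (x , _) o → ≢-T (all-corners loopless x) (V.orbit⇒≡ o)
        ; noMultipleEdges = λ (x , _) (y , _) o o′ →
            corner-unique x y (V.orbit⇒≡ o) (inj₁ (V.orbit⇒≡ o′))
        }
      ; minValence3 = λ (x , _) →
          (λ e → ≢-T (all-corners valence₁ x) (trans (next-! u x) (cong toℕ e)))
        , (λ e → ≢-T (all-corners valence₂ x)
            (trans (cong (nexts U !_) (next-! u x)) (trans (next-! u (next M x)) (cong toℕ e))))
      ; closedCells = λ (x , _) (y , _) o o′ →
          corner-unique x y (V.orbit⇒≡ o′) (inj₂ (F′.orbit⇒≡ o))
      }

-- Rotation systems

-- The neighbours of each vertex 0, 1, 2, … in cyclic order.  The darts are
-- numbered in the order of this list.
Rotations : Set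
Rotations = List (List ℕ)

darts : ℕ → Rotations → List (ℕ × ℕ)
darts u []      = []
darts u (l ∷ R) = map (u ,_) l ++ darts (suc u) R

indexOf : (A → Bool) → List A → ℕ
indexOf p []       = 0
indexOf p (x ∷ xs) = if p x then 0 else suc (indexOf p xs)

cycles : ℕ → Rotations → List ℕ
cycles o []      = []
cycles o (l ∷ R) = applyUpTo (λ i → suc (o + i)) (pred (length l)) ++ o ∷ cycles (o + length l) R

-- The least index of an orbit is a label lying in that orbit, as `Orbits` requires. Vertex labels
-- are then the numbers of first darts and increase with the vertices. `_⊓′_` is the minimum that
-- evaluates through a Boolean comparison.
orbitMins : List ℕ → List ℕ
orbitMins t = map (λ z → foldr _⊓′_ z (iterate (t !_) z (length t))) (upTo (length t))

toTables : Rotations → Tables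
toTables R = label (reversals (darts 0 R)) (cycles 0 R)
  where
  -- In a simple graph a dart is determined by its ordered pair of ends, so the reversed dart is
  -- found by exchanging them.
  reversals : List (ℕ × ℕ) → List ℕ
  reversals D = map (λ (u , v) → indexOf (λ (u′ , v′) → (u′ ≡ᵇ v) ∧ (v′ ≡ᵇ u)) D) D

  label : List ℕ → List ℕ → Tables
  label r s = tables r s (orbitMins s) (orbitMins (map (s !_) r))

inverse : List ℕ → List ℕ
inverse t = map (λ z → indexOf (_≡ᵇ z) t) (upTo (length t))

-- The fallback `x` makes this total. The equations `revs-table` and `nexts-table` in `Valid` rule
-- it out: an entry that is out of range differs from every `toℕ` of an element of `Fin n`.
at : List ℕ → Fin n → Fin n
at {n} t x with t ! toℕ x <? n
... | yes l = fromℕ< l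
... | no _  = x

Rotates : (r s s⁻¹ : List ℕ) → Fin n → Set
Rotates r s s⁻¹ x = at r (at r x) ≡ x × at r x ≢ x ×
                    at s (at s⁻¹ x) ≡ x × at s⁻¹ (at s x) ≡ x

graph : ∀ r s s⁻¹ → (∀ (x : Fin n) → Rotates r s s⁻¹ x) → EmbeddedGraph n
graph r s s⁻¹ h = record
  { α            = permutation (at r) (at r) (proj₁ ∘ h) (proj₁ ∘ h)
  ; σ            = permutation (at s) (at s⁻¹)
                     (proj₁ ∘ proj₂ ∘ proj₂ ∘ h) (proj₂ ∘ proj₂ ∘ proj₂ ∘ h)
  ; α-involutive = proj₁ ∘ h
  ; σ-unused     = λ x e → ⊥-elim (proj₁ (proj₂ (h x)) e)
  }

labelled : ℕ → (ℕ → ℕ) → List ℕ → Bool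
labelled n g ℓ = all (λ z → (ℓ ! g z ≡ᵇ ℓ ! z) ∧ reaches g n z (ℓ ! z)) (upTo n)

module _ (g : ℕ → ℕ) (p : Fin n → Fin n) (e : ∀ x → g (toℕ x) ≡ toℕ (p x))
         (ℓ : List ℕ) (h : T (labelled n g ℓ)) where

  private
    parts : ∀ x → T (ℓ ! g (toℕ x) ≡ᵇ ℓ ! toℕ x) × T (reaches g n (toℕ x) (ℓ ! toℕ x))
    parts x = ∧-T (ℓ ! g (toℕ x) ≡ᵇ ℓ ! toℕ x) (all-T _ toℕ (applyUpTo-tabulate id n) h x)

  labelled⇒inv : ∀ x → ℓ ! toℕ (p x) ≡ ℓ ! toℕ x
  labelled⇒inv x = trans (cong (ℓ !_) (sym (e x))) (≡ᵇ⇒≡ _ _ (proj₁ (parts x)))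

  labelled⇒rooted : ∀ x → ∃[ w ] toℕ w ≡ ℓ ! toℕ x × Orbit p x w
  labelled⇒rooted x = reaches-sound g p e n x (proj₂ (parts x))

-- Tables that realise a polyhedral map.

record Valid (n : ℕ) (U : Tables) (s⁻¹ : List ℕ) : Set where
  private
    r = revs U
    s = nexts U
    v = vertices U
    f = faces U
  field
    rotates         : ∀ (x : Fin n) → Rotates r s s⁻¹ x
    revs-table      : r ≡ tabulate {n = n} (toℕ ∘ at r)
    nexts-table     : s ≡ tabulate {n = n} (toℕ ∘ at s)
    vertices-table  : v ≡ tabulate {n = n} (λ x → v ! toℕ x)
    faces-table     : f ≡ tabulate {n = n} (λ x → f ! toℕ x)
    vertex-labelled : T (labelled n (s !_) v)
    face-labelled   : T (labelled n (λ z → s ! (r ! z)) f)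
    checks          : T (and (polyhedral U (corners U)))
    nonempty        : 0 < n
    euler           : length (roots {n} (λ x → v ! toℕ x)) + length (roots {n} (λ x → f ! toℕ x))
                      ≡ length (roots {n} (λ x → toℕ x ⊓ toℕ (at r x)))

valid? : ∀ n U s⁻¹ → Dec (Valid n U s⁻¹)
valid? n U s⁻¹ = map′
  (λ (a , b , c , d , e , g , h , i , j , k) → record
    { rotates = a ; revs-table = b ; nexts-table = c ; vertices-table = d ; faces-table = e
    ; vertex-labelled = g ; face-labelled = h ; checks = i ; nonempty = j ; euler = k })
  (λ valid → let open Valid valid in
    rotates , revs-table , nexts-table , vertices-table , faces-table
    , vertex-labelled , face-labelled , checks , nonempty , euler)
  (F.all? (λ x → _ F.≟ _ ×-dec ¬? (_ F.≟ _) ×-dec _ F.≟ _ ×-dec _ F.≟ _) ×-dec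
    ≡-dec _≟_ _ _ ×-dec ≡-dec _≟_ _ _ ×-dec ≡-dec _≟_ _ _ ×-dec ≡-dec _≟_ _ _ ×-dec
    T? _ ×-dec T? _ ×-dec T? _ ×-dec _ <? _ ×-dec _ ≟ _)

-- Deletion and contraction of d merge two labels into that of d.  In all maps
-- below the merged face is one of two faces that meet improperly, and the
-- merged vertex is one of two vertices at which two faces meet improperly.
improperAtFace improperAtVertex : ℕ → Tables → Bool
improperAtFace   d U = improper (λ c → face c ≡ᵇ faces U ! d) U
improperAtVertex d U = improper (λ c → vertex c ≡ᵇ vertices U ! d) U

irreducible : ℕ → Tables → Bool
irreducible n U =
  all (λ d → improperAtFace d (removeₜ U d) ∧ improperAtVertex d (shrinkₜ U d)) (upTo n)

module Realisation (U : Tables) (s⁻¹ : List ℕ) (valid : Valid n U s⁻¹) where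

  private
    r = revs U
    s = nexts U
    v = vertices U
    f = faces U

  open Valid valid

  M : EmbeddedGraph n
  M = graph r s s⁻¹ rotates

  private
    next-≡ : ∀ x → s ! toℕ x ≡ toℕ (next M x)
    next-≡ = tabulate-! _ (nexts-table)

    along-≡ : ∀ x → s ! (r ! toℕ x) ≡ toℕ (along M x)
    along-≡ x = trans (cong (s !_) (tabulate-! _ (revs-table) x)) (next-≡ (rev M x))

  u : U ⊨ M
  u = record
    { revs≡      = revs-table
    ; nexts≡     = nexts-table
    ; vertexOf   = λ x → v ! toℕ x
    ; faceOf     = λ x → f ! toℕ x
    ; vertices≡  = vertices-table
    ; faces≡     = faces-table
    ; vertex-inv = labelled⇒inv _ (next M) next-≡ v vertex-labelled
    ; face-inv   = labelled⇒inv _ (along M) along-≡ f face-labelled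
    }

  isDart : ∀ x → IsDart M x
  isDart x = proj₁ (proj₂ (rotates x))

  open Polyhedral u isDart
    (labelled⇒rooted _ (next M) next-≡ v vertex-labelled)
    (labelled⇒rooted _ (along M) along-≡ f face-labelled) public

  isTPM : IsTPM M
  isTPM = record
    { isMap        = isMap polyhedral-U (fromℕ< nonempty) euler
    ; meetProperly = meetProperly polyhedral-U
    }
    where polyhedral-U = and-T (polyhedral U (corners U)) checks

  diminimal : T (irreducible n U) → Diminimal M
  diminimal h = record
    { isTPM          = isTPM
    ; noneRemovable  = λ (d , _) →
        improper⇒¬tpm (remove-⊨ u d) (λ c → face c ≡ᵇ faces (removeₜ U (toℕ d)) ! toℕ d)
          (proj₁ (irreducibleAt d))
    ; noneShrinkable = λ (d , _) →
        improper⇒¬tpm (shrink-⊨ u d) (λ c → vertex c ≡ᵇ vertices (shrinkₜ U (toℕ d)) ! toℕ d)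
          (proj₂ (irreducibleAt d))
    }
    where
    irreducibleAt : ∀ d → T (improperAtFace (toℕ d) (removeₜ U (toℕ d))) ×
                          T (improperAtVertex (toℕ d) (shrinkₜ U (toℕ d)))
    irreducibleAt d = ∧-T (improperAtFace (toℕ d) (removeₜ U (toℕ d)))
      (all-T _ toℕ (applyUpTo-tabulate id n) h d)

-- Isomorphism

weight : Bool → ℕ
weight b = if b then 1 else 0

-- The sum over all vertices of (Σ |F|³)³, where F runs through the faces at
-- the vertex and |F| is the number of vertices of F.
profile : ∀ {k l} → (Fin k → Fin l → Bool) → ℕ
profile I = sum λ i → (sum λ j → weight (I i j) * (sum λ i′ → weight (I i′ j)) ^ 3) ^ 3

profile-permute : ∀ {k k′ l l′} (I : Fin k → Fin l → Bool) (J : Fin k′ → Fin l′ → Bool)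
  (π : Permutation k k′) (ρ : Permutation l l′) →
  (∀ i j → I i j ≡ J (π ⟨$⟩ʳ i) (ρ ⟨$⟩ʳ j)) → profile I ≡ profile J
profile-permute I J π ρ e = sym (trans (sum-permute _ π) (sum-cong-≗ λ i →
  cong (_^ 3) (trans (sum-permute _ ρ) (sum-cong-≗ λ j →
    cong₂ (λ a b → weight a * b ^ 3) (sym (e i j))
      (trans (sum-permute _ π) (sum-cong-≗ λ i′ → cong weight (sym (e i′ j))))))))

-- During evaluation every entry of the matrix is computed once only.
tabulatedProfile : ∀ {k l} → (Fin k → Fin l → Bool) → ℕ
tabulatedProfile I = go (Vec.tabulate (λ i → Vec.tabulate (I i)))
  where
  go : ∀ {k l} → Vec (Vec Bool l) k → ℕ
  go m = profile (λ i j → Vec.lookup (Vec.lookup m i) j)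

tabulatedProfile≡ : ∀ {k l} (I : Fin k → Fin l → Bool) → tabulatedProfile I ≡ profile I
tabulatedProfile≡ I = profile-permute _ I Perm.id Perm.id λ i j →
  trans (cong (λ row → Vec.lookup row j) (Vec.lookup∘tabulate (λ i → Vec.tabulate (I i)) i))
        (Vec.lookup∘tabulate (I i) j)

record Incidence (M : EmbeddedGraph n) : Set where
  field
    #vertices #faces : ℕ
    vertexAt : HasCardinality (Vertices M) #vertices
    faceAt   : HasCardinality (Faces M) #faces
    incident : Fin #vertices → Fin #faces → Bool
    incident⇔ : ∀ i j → T (incident i j) ⇔
      VertexOnFace M (proj₁ (Bijection.to vertexAt i)) (proj₁ (Bijection.to faceAt j))

module _ {S : Setoid 0ℓ 0ℓ} {k l : ℕ}
         (b : Bijection (≡.setoid (Fin k)) S) (c : Bijection (≡.setoid (Fin l)) S) where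

  private
    module S = Setoid S
    module B = Bijection b
    module C = Bijection c

    onto : ∀ i → C.to (proj₁ (C.surjective (B.to i))) S.≈ B.to i
    onto i = proj₂ (C.surjective (B.to i)) refl

    onto⁻¹ : ∀ j → B.to (proj₁ (B.surjective (C.to j))) S.≈ C.to j
    onto⁻¹ j = proj₂ (B.surjective (C.to j)) refl

  -- Two numberings of the same classes differ by a permutation, obtained by looking up in each
  -- numbering the classes listed by the other.
  matching : Permutation k l
  matching = permutation
    (λ i → proj₁ (C.surjective (B.to i))) (λ j → proj₁ (B.surjective (C.to j)))
    (λ j → C.injective (S.trans (onto _) (onto⁻¹ j)))
    (λ i → B.injective (S.trans (onto⁻¹ _) (onto i)))

  matching-≈ : ∀ i → C.to (matching ⟨$⟩ʳ i) S.≈ B.to i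
  matching-≈ = onto

vertexOnFace-resp : (M : EmbeddedGraph n) → ∀ {x y f g} → SameVertex M x y → SameFace M f g →
                    VertexOnFace M x f → VertexOnFace M y g
vertexOnFace-resp M p q (z , xz , fz) = z , Eq.symmetric _ p ◅◅ xz , Eq.symmetric _ q ◅◅ fz

profile-≅ : ∀ {m n} {M : EmbeddedGraph m} {N : EmbeddedGraph n} → M ≅ N →
            (I : Incidence M) (J : Incidence N) →
            profile (Incidence.incident I) ≡ profile (Incidence.incident J)
profile-≅ {M = M} {N} iso I J =
  profile-permute I.incident J.incident (matching v J.vertexAt) (matching f J.faceAt) λ i j →
    does-⇔ (mk⇔
      (λ h → Equivalence.from (J.incident⇔ _ _)
        (vertexOnFace-resp N (Eq.symmetric _ (v-≈ i)) (Eq.symmetric _ (f-≈ j))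
          (Equivalence.to (incidence _ _) (Equivalence.to (I.incident⇔ i j) h))))
      (λ h → Equivalence.from (I.incident⇔ i j) (Equivalence.from (incidence _ _)
        (vertexOnFace-resp N (v-≈ i) (f-≈ j) (Equivalence.to (J.incident⇔ _ _) h)))))
    (T? _) (T? _)
  where
  open _≅_ iso
  module I = Incidence I
  module J = Incidence J
  -- The vertices of `N` are numbered a second time, through the isomorphism, and compared with
  -- their own numbering; likewise the faces.
  v = Compose.bijection I.vertexAt vertexMap
  f = Compose.bijection I.faceAt faceMap
  v-≈ = matching-≈ v J.vertexAt
  f-≈ = matching-≈ f J.faceAt

incidences : List Corner → ∀ (vs fs : List (Fin n)) → Fin (length vs) → Fin (length fs) → Bool
incidences C vs fs i j =
  any (λ c → (vertex c ≡ᵇ toℕ (lookup vs i)) ∧ (face c ≡ᵇ toℕ (lookup fs j))) C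

-- Only tables enter, so evaluation meets no validity proof; the matrix is by definition the one in
-- `incidenceOf`.
signature : ℕ → Tables → ℕ
signature n U = tabulatedProfile (incidences (corners U)
  (roots {n} (λ x → vertices U ! toℕ x)) (roots {n} (λ x → faces U ! toℕ x)))

module _ {n : ℕ} (U : Tables) (s⁻¹ : List ℕ) (valid : Valid n U s⁻¹) where

  open Realisation U s⁻¹ valid

  private
    vs = roots (vertexOf u)
    fs = roots (faceOf u)

  incidenceOf : Incidence M
  incidenceOf = record
    { vertexAt  = V.cardinality isDart
    ; faceAt    = F′.cardinality isDart
    ; incident  = incidences (corners U) vs fs
    ; incident⇔ = λ i j → mk⇔ (to i j) (from i j)
    }
    where
    to : ∀ i j → T (incidences (corners U) vs fs i j) →
         VertexOnFace M (lookup vs i) (lookup fs j)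
    to i j h with any-corners u h
    ... | z , h with ∧-T (vertexOf u z ≡ᵇ toℕ (lookup vs i)) h
    ... | a , b = z
      , V.≡⇒orbit _ z (trans (V.ℓ-root i) (sym (≡ᵇ⇒≡ _ _ a)))
      , F′.≡⇒orbit _ z (trans (F′.ℓ-root j) (sym (≡ᵇ⇒≡ _ _ b)))

    from : ∀ i j → VertexOnFace M (lookup vs i) (lookup fs j) →
           T (incidences (corners U) vs fs i j)
    from i j (z , xz , fz) = any-T⁺ _ (cornerAt u) (corners≡ u) z (Equivalence.from T-∧
      ( ≡⇒≡ᵇ _ _ (trans (sym (V.orbit⇒≡ xz)) (V.ℓ-root i))
      , ≡⇒≡ᵇ _ _ (trans (sym (F′.orbit⇒≡ fz)) (F′.ℓ-root j))))

signature-≅ : ∀ {m n} {U U′ s⁻¹ s′⁻¹} (h : Valid m U s⁻¹) (h′ : Valid n U′ s′⁻¹) →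
  Realisation.M U s⁻¹ h ≅ Realisation.M U′ s′⁻¹ h′ → signature m U ≡ signature n U′
signature-≅ {U = U} {U′} {s⁻¹} {s′⁻¹} h h′ iso = begin
  tabulatedProfile I.incident ≡⟨ tabulatedProfile≡ I.incident ⟩
  profile I.incident          ≡⟨ profile-≅ iso (incidenceOf U s⁻¹ h) (incidenceOf U′ s′⁻¹ h′) ⟩
  profile J.incident          ≡⟨ tabulatedProfile≡ J.incident ⟨
  tabulatedProfile J.incident ∎
  where
  open ≡-Reasoning
  module I = Incidence (incidenceOf U s⁻¹ h)
  module J = Incidence (incidenceOf U′ s′⁻¹ h′)

-- Certificates and assembly.

Certified : Tables → Set
Certified U = Valid (length (revs U)) U (inverse (nexts U)) × T (irreducible (length (revs U)) U)

certified? : ∀ U → Dec (Certified U)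
certified? U = valid? (length (revs U)) U (inverse (nexts U)) ×-dec T? _

signatureOf : Tables → ℕ
signatureOf U = signature (length (revs U)) U

-- An arbitrary family keeps this argument apart from the evaluation of the concrete tables.
diminimalFamily : ∀ {k} (U : Fin k → Tables) → (∀ i → Certified (U i)) →
  (∀ i j → signatureOf (U i) ≡ signatureOf (U j) → i ≡ j) →
  Σ[ n ∈ (Fin k → ℕ) ] Σ[ M ∈ (∀ i → EmbeddedGraph (n i)) ]
    ((∀ i → Diminimal (M i)) × (∀ i j → i ≢ j → ¬ (M i ≅ M j)))
diminimalFamily U certified injective =
  (λ i → length (revs (U i))) , R.M ,
  (λ i → R.diminimal i (proj₂ (certified i))) ,
  (λ i j i≢j iso → i≢j (injective i j
    (signature-≅ {U = U i} {U j} (proj₁ (certified i)) (proj₁ (certified j)) iso)))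
  where module R i = Realisation (U i) (inverse (nexts (U i))) (proj₁ (certified i))

-- The maps

-- The systems are ordered by the number of vertices, from seven to fourteen. The first is the
-- triangulation of the torus by the complete graph on seven vertices; the last is its dual type,
-- seven pairwise adjacent hexagons.
rotationSystems : List Rotations
rotationSystems =
  ((1 ∷ 2 ∷ 3 ∷ 4 ∷ 5 ∷ 6 ∷ []) ∷ (0 ∷ 6 ∷ 4 ∷ 3 ∷ 5 ∷ 2 ∷ []) ∷ (0 ∷ 1 ∷ 5 ∷ 4 ∷ 6 ∷ 3 ∷ []) ∷
    (0 ∷ 2 ∷ 6 ∷ 5 ∷ 1 ∷ 4 ∷ []) ∷ (0 ∷ 3 ∷ 1 ∷ 6 ∷ 2 ∷ 5 ∷ []) ∷ (0 ∷ 4 ∷ 2 ∷ 1 ∷ 3 ∷ 6 ∷ []) ∷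
    (0 ∷ 5 ∷ 3 ∷ 2 ∷ 4 ∷ 1 ∷ []) ∷ []) ∷
  ((1 ∷ 2 ∷ 3 ∷ 4 ∷ []) ∷ (0 ∷ 5 ∷ 6 ∷ 7 ∷ []) ∷ (0 ∷ 7 ∷ 5 ∷ 4 ∷ 6 ∷ []) ∷
    (0 ∷ 6 ∷ 5 ∷ 7 ∷ 4 ∷ []) ∷ (0 ∷ 3 ∷ 7 ∷ 6 ∷ 2 ∷ 5 ∷ []) ∷ (1 ∷ 4 ∷ 2 ∷ 7 ∷ 3 ∷ []) ∷
    (1 ∷ 3 ∷ 2 ∷ 4 ∷ 7 ∷ []) ∷ (1 ∷ 6 ∷ 4 ∷ 3 ∷ 5 ∷ 2 ∷ []) ∷ []) ∷
  ((1 ∷ 2 ∷ 3 ∷ []) ∷ (0 ∷ 4 ∷ 5 ∷ 6 ∷ 7 ∷ []) ∷ (0 ∷ 7 ∷ 5 ∷ 4 ∷ 6 ∷ []) ∷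
    (0 ∷ 6 ∷ 5 ∷ 7 ∷ 4 ∷ []) ∷ (1 ∷ 3 ∷ 7 ∷ 6 ∷ 2 ∷ 5 ∷ []) ∷ (1 ∷ 4 ∷ 2 ∷ 7 ∷ 3 ∷ 6 ∷ []) ∷
    (1 ∷ 5 ∷ 3 ∷ 2 ∷ 4 ∷ 7 ∷ []) ∷ (1 ∷ 6 ∷ 4 ∷ 3 ∷ 5 ∷ 2 ∷ []) ∷ []) ∷
  ((1 ∷ 2 ∷ 3 ∷ 4 ∷ []) ∷ (0 ∷ 5 ∷ 3 ∷ 6 ∷ []) ∷ (0 ∷ 6 ∷ 5 ∷ 7 ∷ []) ∷ (0 ∷ 7 ∷ 1 ∷ 8 ∷ []) ∷
    (0 ∷ 8 ∷ 7 ∷ 5 ∷ []) ∷ (1 ∷ 4 ∷ 2 ∷ 8 ∷ []) ∷ (1 ∷ 7 ∷ 8 ∷ 2 ∷ []) ∷ (2 ∷ 4 ∷ 6 ∷ 3 ∷ []) ∷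
    (3 ∷ 5 ∷ 6 ∷ 4 ∷ []) ∷ []) ∷
  ((1 ∷ 2 ∷ 3 ∷ []) ∷ (0 ∷ 4 ∷ 5 ∷ []) ∷ (0 ∷ 6 ∷ 4 ∷ 7 ∷ 8 ∷ []) ∷ (0 ∷ 8 ∷ 6 ∷ 7 ∷ []) ∷
    (1 ∷ 7 ∷ 2 ∷ 6 ∷ 8 ∷ []) ∷ (1 ∷ 8 ∷ 7 ∷ 6 ∷ []) ∷ (2 ∷ 5 ∷ 3 ∷ 8 ∷ 4 ∷ []) ∷
    (2 ∷ 4 ∷ 3 ∷ 5 ∷ 8 ∷ []) ∷ (2 ∷ 7 ∷ 5 ∷ 4 ∷ 6 ∷ 3 ∷ []) ∷ []) ∷
  ((1 ∷ 2 ∷ 3 ∷ []) ∷ (0 ∷ 4 ∷ 5 ∷ 6 ∷ []) ∷ (0 ∷ 6 ∷ 4 ∷ 7 ∷ 5 ∷ []) ∷ (0 ∷ 8 ∷ 7 ∷ 4 ∷ []) ∷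
    (1 ∷ 3 ∷ 7 ∷ 2 ∷ 6 ∷ 8 ∷ []) ∷ (1 ∷ 8 ∷ 2 ∷ 7 ∷ []) ∷ (1 ∷ 7 ∷ 8 ∷ 4 ∷ 2 ∷ []) ∷
    (2 ∷ 4 ∷ 3 ∷ 6 ∷ 5 ∷ []) ∷ (3 ∷ 5 ∷ 4 ∷ 6 ∷ []) ∷ []) ∷
  ((1 ∷ 2 ∷ 3 ∷ []) ∷ (0 ∷ 4 ∷ 5 ∷ 6 ∷ []) ∷ (0 ∷ 6 ∷ 4 ∷ 7 ∷ 5 ∷ []) ∷
    (0 ∷ 5 ∷ 8 ∷ 7 ∷ 4 ∷ []) ∷ (1 ∷ 3 ∷ 7 ∷ 2 ∷ 8 ∷ []) ∷ (1 ∷ 8 ∷ 3 ∷ 2 ∷ 7 ∷ []) ∷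
    (1 ∷ 7 ∷ 8 ∷ 2 ∷ []) ∷ (2 ∷ 4 ∷ 3 ∷ 6 ∷ 5 ∷ []) ∷ (3 ∷ 5 ∷ 4 ∷ 6 ∷ []) ∷ []) ∷
  ((1 ∷ 2 ∷ 3 ∷ []) ∷ (0 ∷ 4 ∷ 5 ∷ 6 ∷ 7 ∷ []) ∷ (0 ∷ 7 ∷ 8 ∷ 6 ∷ []) ∷ (0 ∷ 5 ∷ 7 ∷ 4 ∷ []) ∷
    (1 ∷ 3 ∷ 7 ∷ 6 ∷ 8 ∷ []) ∷ (1 ∷ 8 ∷ 3 ∷ 6 ∷ []) ∷ (1 ∷ 5 ∷ 2 ∷ 4 ∷ 7 ∷ []) ∷
    (1 ∷ 6 ∷ 4 ∷ 3 ∷ 8 ∷ 2 ∷ []) ∷ (2 ∷ 7 ∷ 5 ∷ 4 ∷ []) ∷ []) ∷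
  ((1 ∷ 2 ∷ 3 ∷ 4 ∷ 5 ∷ []) ∷ (0 ∷ 5 ∷ 3 ∷ 6 ∷ 2 ∷ []) ∷ (0 ∷ 1 ∷ 4 ∷ 7 ∷ 8 ∷ []) ∷
    (0 ∷ 8 ∷ 1 ∷ 7 ∷ []) ∷ (0 ∷ 7 ∷ 2 ∷ 6 ∷ []) ∷ (0 ∷ 6 ∷ 8 ∷ 7 ∷ 1 ∷ []) ∷
    (1 ∷ 8 ∷ 5 ∷ 4 ∷ []) ∷ (2 ∷ 4 ∷ 3 ∷ 5 ∷ []) ∷ (2 ∷ 5 ∷ 6 ∷ 3 ∷ []) ∷ []) ∷
  ((1 ∷ 2 ∷ 3 ∷ []) ∷ (0 ∷ 4 ∷ 5 ∷ 6 ∷ []) ∷ (0 ∷ 6 ∷ 7 ∷ 8 ∷ 5 ∷ []) ∷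
    (0 ∷ 5 ∷ 7 ∷ 6 ∷ 8 ∷ []) ∷ (1 ∷ 8 ∷ 7 ∷ []) ∷ (1 ∷ 7 ∷ 3 ∷ 2 ∷ 8 ∷ 6 ∷ []) ∷
    (1 ∷ 5 ∷ 8 ∷ 3 ∷ 7 ∷ 2 ∷ []) ∷ (2 ∷ 6 ∷ 3 ∷ 5 ∷ 4 ∷ []) ∷ (2 ∷ 4 ∷ 3 ∷ 6 ∷ 5 ∷ []) ∷ []) ∷
  ((1 ∷ 2 ∷ 3 ∷ []) ∷ (0 ∷ 4 ∷ 5 ∷ 6 ∷ []) ∷ (0 ∷ 6 ∷ 4 ∷ 7 ∷ 8 ∷ []) ∷
    (0 ∷ 8 ∷ 6 ∷ 7 ∷ 4 ∷ []) ∷ (1 ∷ 3 ∷ 7 ∷ 2 ∷ 6 ∷ 8 ∷ []) ∷ (1 ∷ 8 ∷ 7 ∷ []) ∷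
    (1 ∷ 7 ∷ 3 ∷ 8 ∷ 4 ∷ 2 ∷ []) ∷ (2 ∷ 4 ∷ 3 ∷ 6 ∷ 5 ∷ []) ∷ (2 ∷ 5 ∷ 4 ∷ 6 ∷ 3 ∷ []) ∷ []) ∷
  ((1 ∷ 2 ∷ 3 ∷ []) ∷ (0 ∷ 4 ∷ 5 ∷ 6 ∷ 7 ∷ []) ∷ (0 ∷ 7 ∷ 4 ∷ 6 ∷ 5 ∷ []) ∷
    (0 ∷ 5 ∷ 7 ∷ 6 ∷ 4 ∷ []) ∷ (1 ∷ 3 ∷ 6 ∷ 2 ∷ 8 ∷ []) ∷ (1 ∷ 8 ∷ 3 ∷ 2 ∷ 6 ∷ []) ∷
    (1 ∷ 5 ∷ 2 ∷ 4 ∷ 3 ∷ 7 ∷ []) ∷ (1 ∷ 6 ∷ 3 ∷ 8 ∷ 2 ∷ []) ∷ (4 ∷ 7 ∷ 5 ∷ []) ∷ []) ∷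
  ((1 ∷ 2 ∷ 3 ∷ 4 ∷ []) ∷ (0 ∷ 5 ∷ 6 ∷ 2 ∷ []) ∷ (0 ∷ 1 ∷ 7 ∷ 8 ∷ []) ∷
    (0 ∷ 8 ∷ 6 ∷ 5 ∷ 7 ∷ []) ∷ (0 ∷ 7 ∷ 6 ∷ 8 ∷ 5 ∷ []) ∷ (1 ∷ 4 ∷ 8 ∷ 7 ∷ 3 ∷ []) ∷
    (1 ∷ 3 ∷ 8 ∷ 4 ∷ 7 ∷ []) ∷ (2 ∷ 6 ∷ 4 ∷ 3 ∷ 5 ∷ []) ∷ (2 ∷ 5 ∷ 4 ∷ 6 ∷ 3 ∷ []) ∷ []) ∷
  ((1 ∷ 2 ∷ 3 ∷ []) ∷ (0 ∷ 4 ∷ 5 ∷ 6 ∷ []) ∷ (0 ∷ 7 ∷ 5 ∷ []) ∷ (0 ∷ 8 ∷ 9 ∷ []) ∷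
    (1 ∷ 9 ∷ 7 ∷ 8 ∷ []) ∷ (1 ∷ 8 ∷ 2 ∷ 9 ∷ 6 ∷ []) ∷ (1 ∷ 5 ∷ 9 ∷ 8 ∷ 7 ∷ []) ∷
    (2 ∷ 6 ∷ 4 ∷ 9 ∷ []) ∷ (3 ∷ 5 ∷ 4 ∷ 6 ∷ []) ∷ (3 ∷ 6 ∷ 5 ∷ 7 ∷ 4 ∷ []) ∷ []) ∷
  ((1 ∷ 2 ∷ 3 ∷ []) ∷ (0 ∷ 4 ∷ 5 ∷ 6 ∷ []) ∷ (0 ∷ 7 ∷ 8 ∷ []) ∷ (0 ∷ 5 ∷ 7 ∷ 6 ∷ 4 ∷ []) ∷
    (1 ∷ 3 ∷ 9 ∷ 7 ∷ 5 ∷ []) ∷ (1 ∷ 4 ∷ 7 ∷ 3 ∷ 8 ∷ []) ∷ (1 ∷ 9 ∷ 3 ∷ 7 ∷ []) ∷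
    (2 ∷ 6 ∷ 3 ∷ 5 ∷ 4 ∷ []) ∷ (2 ∷ 9 ∷ 5 ∷ []) ∷ (4 ∷ 6 ∷ 8 ∷ []) ∷ []) ∷
  ((1 ∷ 2 ∷ 3 ∷ []) ∷ (0 ∷ 4 ∷ 5 ∷ 6 ∷ []) ∷ (0 ∷ 6 ∷ 4 ∷ 7 ∷ []) ∷ (0 ∷ 8 ∷ 9 ∷ 4 ∷ []) ∷
    (1 ∷ 3 ∷ 9 ∷ 2 ∷ 6 ∷ 8 ∷ []) ∷ (1 ∷ 8 ∷ 7 ∷ []) ∷ (1 ∷ 9 ∷ 8 ∷ 4 ∷ 2 ∷ []) ∷
    (2 ∷ 9 ∷ 5 ∷ []) ∷ (3 ∷ 5 ∷ 4 ∷ 6 ∷ []) ∷ (3 ∷ 6 ∷ 7 ∷ 4 ∷ []) ∷ []) ∷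
  ((1 ∷ 2 ∷ 3 ∷ []) ∷ (0 ∷ 4 ∷ 5 ∷ 6 ∷ []) ∷ (0 ∷ 6 ∷ 4 ∷ 7 ∷ 5 ∷ []) ∷ (0 ∷ 8 ∷ 7 ∷ 4 ∷ []) ∷
    (1 ∷ 3 ∷ 7 ∷ 2 ∷ 9 ∷ []) ∷ (1 ∷ 8 ∷ 2 ∷ 7 ∷ []) ∷ (1 ∷ 7 ∷ 9 ∷ 2 ∷ []) ∷
    (2 ∷ 4 ∷ 3 ∷ 6 ∷ 5 ∷ []) ∷ (3 ∷ 5 ∷ 9 ∷ []) ∷ (4 ∷ 6 ∷ 8 ∷ []) ∷ []) ∷
  ((1 ∷ 2 ∷ 3 ∷ []) ∷ (0 ∷ 4 ∷ 5 ∷ 6 ∷ []) ∷ (0 ∷ 6 ∷ 7 ∷ 8 ∷ 5 ∷ []) ∷ (0 ∷ 9 ∷ 6 ∷ 4 ∷ []) ∷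
    (1 ∷ 3 ∷ 8 ∷ 7 ∷ []) ∷ (1 ∷ 9 ∷ 2 ∷ 8 ∷ []) ∷ (1 ∷ 8 ∷ 3 ∷ 7 ∷ 2 ∷ []) ∷
    (2 ∷ 6 ∷ 9 ∷ 4 ∷ []) ∷ (2 ∷ 4 ∷ 6 ∷ 5 ∷ []) ∷ (3 ∷ 5 ∷ 7 ∷ []) ∷ []) ∷
  ((1 ∷ 2 ∷ 3 ∷ []) ∷ (0 ∷ 4 ∷ 5 ∷ 6 ∷ []) ∷ (0 ∷ 7 ∷ 4 ∷ 8 ∷ []) ∷ (0 ∷ 8 ∷ 7 ∷ 9 ∷ []) ∷
    (1 ∷ 9 ∷ 2 ∷ 5 ∷ []) ∷ (1 ∷ 4 ∷ 7 ∷ 8 ∷ []) ∷ (1 ∷ 8 ∷ 9 ∷ 7 ∷ []) ∷ (2 ∷ 6 ∷ 3 ∷ 5 ∷ []) ∷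
    (2 ∷ 9 ∷ 6 ∷ 5 ∷ 3 ∷ []) ∷ (3 ∷ 6 ∷ 8 ∷ 4 ∷ []) ∷ []) ∷
  ((1 ∷ 2 ∷ 3 ∷ []) ∷ (0 ∷ 4 ∷ 5 ∷ 6 ∷ []) ∷ (0 ∷ 7 ∷ 4 ∷ 8 ∷ []) ∷ (0 ∷ 8 ∷ 5 ∷ 9 ∷ []) ∷
    (1 ∷ 9 ∷ 2 ∷ 5 ∷ []) ∷ (1 ∷ 4 ∷ 7 ∷ 3 ∷ 8 ∷ []) ∷ (1 ∷ 8 ∷ 7 ∷ []) ∷ (2 ∷ 6 ∷ 9 ∷ 5 ∷ []) ∷
    (2 ∷ 9 ∷ 6 ∷ 5 ∷ 3 ∷ []) ∷ (3 ∷ 7 ∷ 8 ∷ 4 ∷ []) ∷ []) ∷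
  ((1 ∷ 2 ∷ 3 ∷ []) ∷ (0 ∷ 4 ∷ 5 ∷ 6 ∷ 7 ∷ []) ∷ (0 ∷ 7 ∷ 4 ∷ 8 ∷ []) ∷ (0 ∷ 8 ∷ 9 ∷ 4 ∷ []) ∷
    (1 ∷ 3 ∷ 6 ∷ 2 ∷ 5 ∷ []) ∷ (1 ∷ 4 ∷ 7 ∷ 8 ∷ []) ∷ (1 ∷ 8 ∷ 4 ∷ 9 ∷ []) ∷
    (1 ∷ 9 ∷ 5 ∷ 2 ∷ []) ∷ (2 ∷ 6 ∷ 5 ∷ 3 ∷ []) ∷ (3 ∷ 7 ∷ 6 ∷ []) ∷ []) ∷
  ((1 ∷ 2 ∷ 3 ∷ []) ∷ (0 ∷ 4 ∷ 5 ∷ 6 ∷ 7 ∷ []) ∷ (0 ∷ 7 ∷ 4 ∷ 6 ∷ []) ∷ (0 ∷ 5 ∷ 8 ∷ 4 ∷ []) ∷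
    (1 ∷ 3 ∷ 8 ∷ 2 ∷ 9 ∷ []) ∷ (1 ∷ 9 ∷ 3 ∷ 6 ∷ []) ∷ (1 ∷ 5 ∷ 2 ∷ 8 ∷ []) ∷
    (1 ∷ 8 ∷ 9 ∷ 2 ∷ []) ∷ (3 ∷ 7 ∷ 6 ∷ 4 ∷ []) ∷ (4 ∷ 7 ∷ 5 ∷ []) ∷ []) ∷
  ((1 ∷ 2 ∷ 3 ∷ 4 ∷ []) ∷ (0 ∷ 5 ∷ 6 ∷ 7 ∷ []) ∷ (0 ∷ 7 ∷ 8 ∷ 6 ∷ []) ∷ (0 ∷ 6 ∷ 5 ∷ 8 ∷ []) ∷
    (0 ∷ 8 ∷ 7 ∷ 5 ∷ []) ∷ (1 ∷ 4 ∷ 9 ∷ 3 ∷ []) ∷ (1 ∷ 3 ∷ 2 ∷ 9 ∷ []) ∷ (1 ∷ 9 ∷ 4 ∷ 2 ∷ []) ∷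
    (2 ∷ 4 ∷ 3 ∷ 9 ∷ []) ∷ (5 ∷ 7 ∷ 6 ∷ 8 ∷ []) ∷ []) ∷
  ((1 ∷ 2 ∷ 3 ∷ []) ∷ (0 ∷ 4 ∷ 5 ∷ []) ∷ (0 ∷ 6 ∷ 7 ∷ []) ∷ (0 ∷ 8 ∷ 9 ∷ []) ∷
    (1 ∷ 9 ∷ 7 ∷ 6 ∷ 8 ∷ []) ∷ (1 ∷ 8 ∷ 7 ∷ 9 ∷ 6 ∷ []) ∷ (2 ∷ 5 ∷ 9 ∷ 8 ∷ 4 ∷ []) ∷
    (2 ∷ 4 ∷ 9 ∷ 5 ∷ 8 ∷ []) ∷ (3 ∷ 7 ∷ 5 ∷ 4 ∷ 6 ∷ []) ∷ (3 ∷ 6 ∷ 5 ∷ 7 ∷ 4 ∷ []) ∷ []) ∷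
  ((1 ∷ 2 ∷ 3 ∷ []) ∷ (0 ∷ 4 ∷ 5 ∷ 6 ∷ []) ∷ (0 ∷ 6 ∷ 7 ∷ 8 ∷ []) ∷ (0 ∷ 8 ∷ 9 ∷ 4 ∷ []) ∷
    (1 ∷ 3 ∷ 7 ∷ 6 ∷ 8 ∷ []) ∷ (1 ∷ 8 ∷ 7 ∷ 9 ∷ []) ∷ (1 ∷ 9 ∷ 8 ∷ 4 ∷ 2 ∷ []) ∷
    (2 ∷ 4 ∷ 9 ∷ 5 ∷ []) ∷ (2 ∷ 5 ∷ 4 ∷ 6 ∷ 3 ∷ []) ∷ (3 ∷ 6 ∷ 5 ∷ 7 ∷ []) ∷ []) ∷
  ((1 ∷ 2 ∷ 3 ∷ []) ∷ (0 ∷ 4 ∷ 5 ∷ 6 ∷ []) ∷ (0 ∷ 6 ∷ 4 ∷ 7 ∷ 8 ∷ []) ∷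
    (0 ∷ 8 ∷ 6 ∷ 7 ∷ 4 ∷ []) ∷ (1 ∷ 3 ∷ 7 ∷ 2 ∷ 9 ∷ []) ∷ (1 ∷ 8 ∷ 7 ∷ []) ∷
    (1 ∷ 7 ∷ 3 ∷ 9 ∷ 2 ∷ []) ∷ (2 ∷ 4 ∷ 3 ∷ 6 ∷ 5 ∷ []) ∷ (2 ∷ 5 ∷ 9 ∷ 3 ∷ []) ∷
    (4 ∷ 6 ∷ 8 ∷ []) ∷ []) ∷
  ((1 ∷ 2 ∷ 3 ∷ []) ∷ (0 ∷ 4 ∷ 5 ∷ 6 ∷ []) ∷ (0 ∷ 7 ∷ 4 ∷ 8 ∷ []) ∷ (0 ∷ 5 ∷ 7 ∷ 9 ∷ []) ∷
    (1 ∷ 9 ∷ 2 ∷ 7 ∷ 5 ∷ []) ∷ (1 ∷ 4 ∷ 7 ∷ 3 ∷ 8 ∷ []) ∷ (1 ∷ 8 ∷ 9 ∷ 7 ∷ []) ∷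
    (2 ∷ 6 ∷ 3 ∷ 5 ∷ 4 ∷ []) ∷ (2 ∷ 9 ∷ 6 ∷ 5 ∷ []) ∷ (3 ∷ 6 ∷ 8 ∷ 4 ∷ []) ∷ []) ∷
  ((1 ∷ 2 ∷ 3 ∷ []) ∷ (0 ∷ 4 ∷ 5 ∷ 6 ∷ []) ∷ (0 ∷ 7 ∷ 5 ∷ 8 ∷ []) ∷ (0 ∷ 8 ∷ 6 ∷ 9 ∷ []) ∷
    (1 ∷ 9 ∷ 7 ∷ 8 ∷ []) ∷ (1 ∷ 8 ∷ 2 ∷ 9 ∷ 6 ∷ []) ∷ (1 ∷ 5 ∷ 3 ∷ 8 ∷ 7 ∷ []) ∷
    (2 ∷ 6 ∷ 4 ∷ 9 ∷ []) ∷ (2 ∷ 5 ∷ 4 ∷ 6 ∷ 3 ∷ []) ∷ (3 ∷ 5 ∷ 7 ∷ 4 ∷ []) ∷ []) ∷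
  ((1 ∷ 2 ∷ 3 ∷ []) ∷ (0 ∷ 4 ∷ 5 ∷ 6 ∷ 7 ∷ []) ∷ (0 ∷ 8 ∷ 6 ∷ 5 ∷ []) ∷ (0 ∷ 5 ∷ 9 ∷ 4 ∷ []) ∷
    (1 ∷ 3 ∷ 6 ∷ 8 ∷ 5 ∷ []) ∷ (1 ∷ 4 ∷ 7 ∷ 3 ∷ 2 ∷ 6 ∷ []) ∷ (1 ∷ 5 ∷ 2 ∷ 4 ∷ 9 ∷ []) ∷
    (1 ∷ 9 ∷ 5 ∷ 8 ∷ []) ∷ (2 ∷ 7 ∷ 4 ∷ []) ∷ (3 ∷ 7 ∷ 6 ∷ []) ∷ []) ∷
  ((1 ∷ 2 ∷ 3 ∷ []) ∷ (0 ∷ 4 ∷ 5 ∷ 6 ∷ 7 ∷ []) ∷ (0 ∷ 7 ∷ 5 ∷ 8 ∷ []) ∷ (0 ∷ 9 ∷ 7 ∷ 4 ∷ []) ∷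
    (1 ∷ 3 ∷ 7 ∷ 8 ∷ 5 ∷ []) ∷ (1 ∷ 4 ∷ 2 ∷ 7 ∷ 9 ∷ []) ∷ (1 ∷ 9 ∷ 8 ∷ 7 ∷ []) ∷
    (1 ∷ 6 ∷ 4 ∷ 3 ∷ 5 ∷ 2 ∷ []) ∷ (2 ∷ 4 ∷ 6 ∷ []) ∷ (3 ∷ 6 ∷ 5 ∷ []) ∷ []) ∷
  ((1 ∷ 2 ∷ 3 ∷ []) ∷ (0 ∷ 4 ∷ 5 ∷ 6 ∷ 7 ∷ []) ∷ (0 ∷ 8 ∷ 4 ∷ 6 ∷ []) ∷ (0 ∷ 6 ∷ 5 ∷ 9 ∷ []) ∷
    (1 ∷ 9 ∷ 6 ∷ 2 ∷ 5 ∷ []) ∷ (1 ∷ 4 ∷ 8 ∷ 3 ∷ 6 ∷ []) ∷ (1 ∷ 5 ∷ 3 ∷ 2 ∷ 4 ∷ 7 ∷ []) ∷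
    (1 ∷ 6 ∷ 9 ∷ 8 ∷ []) ∷ (2 ∷ 7 ∷ 5 ∷ []) ∷ (3 ∷ 7 ∷ 4 ∷ []) ∷ []) ∷
  ((1 ∷ 2 ∷ 3 ∷ 4 ∷ []) ∷ (0 ∷ 5 ∷ 6 ∷ 7 ∷ []) ∷ (0 ∷ 7 ∷ 8 ∷ 9 ∷ []) ∷ (0 ∷ 6 ∷ 8 ∷ 4 ∷ []) ∷
    (0 ∷ 3 ∷ 7 ∷ 9 ∷ 5 ∷ []) ∷ (1 ∷ 4 ∷ 9 ∷ 8 ∷ []) ∷ (1 ∷ 3 ∷ 9 ∷ 7 ∷ []) ∷
    (1 ∷ 6 ∷ 4 ∷ 8 ∷ 2 ∷ []) ∷ (2 ∷ 7 ∷ 3 ∷ 5 ∷ []) ∷ (2 ∷ 5 ∷ 4 ∷ 6 ∷ []) ∷ []) ∷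
  ((1 ∷ 2 ∷ 3 ∷ []) ∷ (0 ∷ 4 ∷ 5 ∷ []) ∷ (0 ∷ 6 ∷ 4 ∷ 7 ∷ []) ∷ (0 ∷ 8 ∷ 6 ∷ 9 ∷ []) ∷
    (1 ∷ 9 ∷ 2 ∷ 10 ∷ []) ∷ (1 ∷ 8 ∷ 9 ∷ 6 ∷ []) ∷ (2 ∷ 5 ∷ 3 ∷ 10 ∷ []) ∷ (2 ∷ 9 ∷ 8 ∷ []) ∷
    (3 ∷ 7 ∷ 5 ∷ 10 ∷ []) ∷ (3 ∷ 5 ∷ 7 ∷ 4 ∷ []) ∷ (4 ∷ 6 ∷ 8 ∷ []) ∷ []) ∷
  ((1 ∷ 2 ∷ 3 ∷ []) ∷ (0 ∷ 4 ∷ 5 ∷ 6 ∷ []) ∷ (0 ∷ 7 ∷ 8 ∷ []) ∷ (0 ∷ 9 ∷ 10 ∷ []) ∷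
    (1 ∷ 10 ∷ 7 ∷ 9 ∷ []) ∷ (1 ∷ 9 ∷ 8 ∷ 6 ∷ []) ∷ (1 ∷ 5 ∷ 10 ∷ 9 ∷ 7 ∷ []) ∷ (2 ∷ 6 ∷ 4 ∷ []) ∷
    (2 ∷ 10 ∷ 5 ∷ []) ∷ (3 ∷ 5 ∷ 4 ∷ 6 ∷ []) ∷ (3 ∷ 6 ∷ 8 ∷ 4 ∷ []) ∷ []) ∷
  ((1 ∷ 2 ∷ 3 ∷ []) ∷ (0 ∷ 4 ∷ 5 ∷ 6 ∷ []) ∷ (0 ∷ 7 ∷ 8 ∷ []) ∷ (0 ∷ 9 ∷ 6 ∷ 4 ∷ []) ∷
    (1 ∷ 3 ∷ 6 ∷ 8 ∷ 10 ∷ []) ∷ (1 ∷ 9 ∷ 8 ∷ []) ∷ (1 ∷ 8 ∷ 4 ∷ 3 ∷ 7 ∷ []) ∷ (2 ∷ 6 ∷ 10 ∷ []) ∷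
    (2 ∷ 4 ∷ 6 ∷ 5 ∷ []) ∷ (3 ∷ 5 ∷ 10 ∷ []) ∷ (4 ∷ 7 ∷ 9 ∷ []) ∷ []) ∷
  ((1 ∷ 2 ∷ 3 ∷ []) ∷ (0 ∷ 4 ∷ 5 ∷ 6 ∷ []) ∷ (0 ∷ 6 ∷ 4 ∷ 7 ∷ []) ∷ (0 ∷ 5 ∷ 8 ∷ 9 ∷ []) ∷
    (1 ∷ 9 ∷ 2 ∷ 8 ∷ []) ∷ (1 ∷ 8 ∷ 3 ∷ 7 ∷ []) ∷ (1 ∷ 10 ∷ 8 ∷ 2 ∷ []) ∷ (2 ∷ 10 ∷ 5 ∷ []) ∷
    (3 ∷ 5 ∷ 4 ∷ 6 ∷ []) ∷ (3 ∷ 10 ∷ 4 ∷ []) ∷ (6 ∷ 7 ∷ 9 ∷ []) ∷ []) ∷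
  ((1 ∷ 2 ∷ 3 ∷ []) ∷ (0 ∷ 4 ∷ 5 ∷ 6 ∷ []) ∷ (0 ∷ 6 ∷ 4 ∷ 7 ∷ []) ∷ (0 ∷ 8 ∷ 9 ∷ 4 ∷ []) ∷
    (1 ∷ 3 ∷ 9 ∷ 2 ∷ 10 ∷ []) ∷ (1 ∷ 8 ∷ 7 ∷ []) ∷ (1 ∷ 9 ∷ 10 ∷ 2 ∷ []) ∷ (2 ∷ 9 ∷ 5 ∷ []) ∷
    (3 ∷ 5 ∷ 10 ∷ []) ∷ (3 ∷ 6 ∷ 7 ∷ 4 ∷ []) ∷ (4 ∷ 6 ∷ 8 ∷ []) ∷ []) ∷
  ((1 ∷ 2 ∷ 3 ∷ []) ∷ (0 ∷ 4 ∷ 5 ∷ 6 ∷ []) ∷ (0 ∷ 7 ∷ 8 ∷ []) ∷ (0 ∷ 9 ∷ 10 ∷ 4 ∷ []) ∷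
    (1 ∷ 3 ∷ 10 ∷ 7 ∷ 5 ∷ []) ∷ (1 ∷ 4 ∷ 9 ∷ 8 ∷ []) ∷ (1 ∷ 10 ∷ 9 ∷ 7 ∷ []) ∷
    (2 ∷ 6 ∷ 9 ∷ 4 ∷ []) ∷ (2 ∷ 10 ∷ 5 ∷ []) ∷ (3 ∷ 5 ∷ 7 ∷ 6 ∷ []) ∷ (3 ∷ 6 ∷ 8 ∷ 4 ∷ []) ∷ []) ∷
  ((1 ∷ 2 ∷ 3 ∷ []) ∷ (0 ∷ 4 ∷ 5 ∷ 6 ∷ 7 ∷ []) ∷ (0 ∷ 8 ∷ 9 ∷ []) ∷ (0 ∷ 6 ∷ 5 ∷ 10 ∷ []) ∷
    (1 ∷ 10 ∷ 9 ∷ 5 ∷ []) ∷ (1 ∷ 4 ∷ 8 ∷ 3 ∷ 6 ∷ []) ∷ (1 ∷ 5 ∷ 3 ∷ 9 ∷ 7 ∷ []) ∷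
    (1 ∷ 6 ∷ 10 ∷ 8 ∷ []) ∷ (2 ∷ 7 ∷ 5 ∷ []) ∷ (2 ∷ 4 ∷ 6 ∷ []) ∷ (3 ∷ 7 ∷ 4 ∷ []) ∷ []) ∷
  ((1 ∷ 2 ∷ 3 ∷ []) ∷ (0 ∷ 4 ∷ 5 ∷ 6 ∷ []) ∷ (0 ∷ 6 ∷ 7 ∷ 8 ∷ []) ∷ (0 ∷ 8 ∷ 9 ∷ 4 ∷ []) ∷
    (1 ∷ 3 ∷ 7 ∷ 6 ∷ 8 ∷ []) ∷ (1 ∷ 8 ∷ 10 ∷ []) ∷ (1 ∷ 9 ∷ 8 ∷ 4 ∷ 2 ∷ []) ∷ (2 ∷ 4 ∷ 10 ∷ []) ∷
    (2 ∷ 5 ∷ 4 ∷ 6 ∷ 3 ∷ []) ∷ (3 ∷ 6 ∷ 10 ∷ []) ∷ (5 ∷ 7 ∷ 9 ∷ []) ∷ []) ∷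
  ((1 ∷ 2 ∷ 3 ∷ []) ∷ (0 ∷ 4 ∷ 5 ∷ 6 ∷ []) ∷ (0 ∷ 6 ∷ 7 ∷ 8 ∷ []) ∷ (0 ∷ 8 ∷ 9 ∷ 4 ∷ []) ∷
    (1 ∷ 3 ∷ 7 ∷ 10 ∷ []) ∷ (1 ∷ 8 ∷ 7 ∷ 9 ∷ []) ∷ (1 ∷ 9 ∷ 10 ∷ 2 ∷ []) ∷ (2 ∷ 4 ∷ 9 ∷ 5 ∷ []) ∷
    (2 ∷ 5 ∷ 10 ∷ 3 ∷ []) ∷ (3 ∷ 6 ∷ 5 ∷ 7 ∷ []) ∷ (4 ∷ 6 ∷ 8 ∷ []) ∷ []) ∷
  ((1 ∷ 2 ∷ 3 ∷ []) ∷ (0 ∷ 4 ∷ 5 ∷ 6 ∷ []) ∷ (0 ∷ 6 ∷ 7 ∷ 8 ∷ []) ∷ (0 ∷ 9 ∷ 10 ∷ 4 ∷ []) ∷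
    (1 ∷ 3 ∷ 7 ∷ 6 ∷ 8 ∷ []) ∷ (1 ∷ 8 ∷ 10 ∷ []) ∷ (1 ∷ 10 ∷ 9 ∷ 4 ∷ 2 ∷ []) ∷ (2 ∷ 4 ∷ 10 ∷ []) ∷
    (2 ∷ 5 ∷ 4 ∷ 9 ∷ []) ∷ (3 ∷ 8 ∷ 6 ∷ []) ∷ (3 ∷ 6 ∷ 5 ∷ 7 ∷ []) ∷ []) ∷
  ((1 ∷ 2 ∷ 3 ∷ []) ∷ (0 ∷ 4 ∷ 5 ∷ 6 ∷ []) ∷ (0 ∷ 6 ∷ 7 ∷ 8 ∷ []) ∷ (0 ∷ 9 ∷ 6 ∷ 10 ∷ []) ∷
    (1 ∷ 10 ∷ 7 ∷ []) ∷ (1 ∷ 9 ∷ 8 ∷ 6 ∷ []) ∷ (1 ∷ 5 ∷ 10 ∷ 3 ∷ 7 ∷ 2 ∷ []) ∷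
    (2 ∷ 6 ∷ 9 ∷ 4 ∷ []) ∷ (2 ∷ 10 ∷ 5 ∷ []) ∷ (3 ∷ 5 ∷ 7 ∷ []) ∷ (3 ∷ 6 ∷ 8 ∷ 4 ∷ []) ∷ []) ∷
  ((1 ∷ 2 ∷ 3 ∷ []) ∷ (0 ∷ 4 ∷ 5 ∷ 6 ∷ []) ∷ (0 ∷ 6 ∷ 7 ∷ 8 ∷ []) ∷ (0 ∷ 9 ∷ 5 ∷ 7 ∷ []) ∷
    (1 ∷ 7 ∷ 10 ∷ []) ∷ (1 ∷ 8 ∷ 7 ∷ 3 ∷ 6 ∷ []) ∷ (1 ∷ 5 ∷ 9 ∷ 7 ∷ 2 ∷ []) ∷
    (2 ∷ 6 ∷ 4 ∷ 3 ∷ 5 ∷ []) ∷ (2 ∷ 5 ∷ 10 ∷ []) ∷ (3 ∷ 10 ∷ 6 ∷ []) ∷ (4 ∷ 9 ∷ 8 ∷ []) ∷ []) ∷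
  ((1 ∷ 2 ∷ 3 ∷ []) ∷ (0 ∷ 4 ∷ 5 ∷ 6 ∷ 7 ∷ []) ∷ (0 ∷ 7 ∷ 8 ∷ 5 ∷ []) ∷ (0 ∷ 5 ∷ 9 ∷ 4 ∷ []) ∷
    (1 ∷ 3 ∷ 8 ∷ 10 ∷ []) ∷ (1 ∷ 10 ∷ 3 ∷ 2 ∷ 6 ∷ []) ∷ (1 ∷ 5 ∷ 8 ∷ 9 ∷ []) ∷
    (1 ∷ 9 ∷ 10 ∷ 2 ∷ []) ∷ (2 ∷ 4 ∷ 6 ∷ []) ∷ (3 ∷ 7 ∷ 6 ∷ []) ∷ (4 ∷ 7 ∷ 5 ∷ []) ∷ []) ∷
  ((1 ∷ 2 ∷ 3 ∷ 4 ∷ []) ∷ (0 ∷ 4 ∷ 5 ∷ 6 ∷ 7 ∷ []) ∷ (0 ∷ 8 ∷ 5 ∷ []) ∷ (0 ∷ 9 ∷ 7 ∷ 6 ∷ []) ∷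
    (0 ∷ 10 ∷ 9 ∷ 1 ∷ []) ∷ (1 ∷ 9 ∷ 2 ∷ 6 ∷ []) ∷ (1 ∷ 5 ∷ 10 ∷ 3 ∷ []) ∷ (1 ∷ 3 ∷ 9 ∷ 8 ∷ []) ∷
    (2 ∷ 7 ∷ 10 ∷ []) ∷ (3 ∷ 5 ∷ 4 ∷ 7 ∷ []) ∷ (4 ∷ 6 ∷ 8 ∷ []) ∷ []) ∷
  ((1 ∷ 2 ∷ 3 ∷ []) ∷ (0 ∷ 4 ∷ 5 ∷ []) ∷ (0 ∷ 6 ∷ 7 ∷ []) ∷ (0 ∷ 8 ∷ 5 ∷ 9 ∷ []) ∷
    (1 ∷ 9 ∷ 10 ∷ []) ∷ (1 ∷ 11 ∷ 3 ∷ 6 ∷ []) ∷ (2 ∷ 5 ∷ 8 ∷ 9 ∷ []) ∷ (2 ∷ 11 ∷ 10 ∷ []) ∷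
    (3 ∷ 10 ∷ 6 ∷ []) ∷ (3 ∷ 11 ∷ 6 ∷ 4 ∷ []) ∷ (4 ∷ 8 ∷ 7 ∷ []) ∷ (5 ∷ 7 ∷ 9 ∷ []) ∷ []) ∷
  ((1 ∷ 2 ∷ 3 ∷ []) ∷ (0 ∷ 4 ∷ 5 ∷ []) ∷ (0 ∷ 6 ∷ 7 ∷ []) ∷ (0 ∷ 8 ∷ 9 ∷ 10 ∷ []) ∷
    (1 ∷ 10 ∷ 11 ∷ []) ∷ (1 ∷ 9 ∷ 8 ∷ 6 ∷ []) ∷ (2 ∷ 5 ∷ 8 ∷ 10 ∷ []) ∷ (2 ∷ 9 ∷ 11 ∷ []) ∷
    (3 ∷ 11 ∷ 6 ∷ 5 ∷ []) ∷ (3 ∷ 5 ∷ 7 ∷ 10 ∷ []) ∷ (3 ∷ 9 ∷ 6 ∷ 4 ∷ []) ∷ (4 ∷ 8 ∷ 7 ∷ []) ∷ []) ∷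
  ((1 ∷ 2 ∷ 3 ∷ []) ∷ (0 ∷ 4 ∷ 5 ∷ 6 ∷ []) ∷ (0 ∷ 7 ∷ 8 ∷ []) ∷ (0 ∷ 9 ∷ 10 ∷ []) ∷
    (1 ∷ 10 ∷ 7 ∷ 11 ∷ []) ∷ (1 ∷ 8 ∷ 10 ∷ 6 ∷ []) ∷ (1 ∷ 5 ∷ 9 ∷ 7 ∷ []) ∷
    (2 ∷ 6 ∷ 4 ∷ 10 ∷ []) ∷ (2 ∷ 5 ∷ 11 ∷ []) ∷ (3 ∷ 11 ∷ 6 ∷ []) ∷ (3 ∷ 5 ∷ 7 ∷ 4 ∷ []) ∷
    (4 ∷ 9 ∷ 8 ∷ []) ∷ []) ∷
  ((1 ∷ 2 ∷ 3 ∷ []) ∷ (0 ∷ 4 ∷ 5 ∷ 6 ∷ 7 ∷ []) ∷ (0 ∷ 8 ∷ 9 ∷ []) ∷ (0 ∷ 10 ∷ 11 ∷ []) ∷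
    (1 ∷ 11 ∷ 9 ∷ 5 ∷ []) ∷ (1 ∷ 4 ∷ 8 ∷ 10 ∷ []) ∷ (1 ∷ 10 ∷ 9 ∷ 7 ∷ []) ∷
    (1 ∷ 6 ∷ 11 ∷ 8 ∷ []) ∷ (2 ∷ 7 ∷ 5 ∷ []) ∷ (2 ∷ 4 ∷ 6 ∷ []) ∷ (3 ∷ 6 ∷ 5 ∷ []) ∷
    (3 ∷ 7 ∷ 4 ∷ []) ∷ []) ∷
  ((1 ∷ 2 ∷ 3 ∷ []) ∷ (0 ∷ 4 ∷ 5 ∷ 6 ∷ []) ∷ (0 ∷ 6 ∷ 7 ∷ 8 ∷ []) ∷ (0 ∷ 8 ∷ 9 ∷ 4 ∷ []) ∷
    (1 ∷ 3 ∷ 7 ∷ 10 ∷ []) ∷ (1 ∷ 8 ∷ 11 ∷ []) ∷ (1 ∷ 9 ∷ 10 ∷ 2 ∷ []) ∷ (2 ∷ 4 ∷ 11 ∷ []) ∷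
    (2 ∷ 5 ∷ 10 ∷ 3 ∷ []) ∷ (3 ∷ 6 ∷ 11 ∷ []) ∷ (4 ∷ 6 ∷ 8 ∷ []) ∷ (5 ∷ 7 ∷ 9 ∷ []) ∷ []) ∷
  ((1 ∷ 2 ∷ 3 ∷ []) ∷ (0 ∷ 4 ∷ 5 ∷ 6 ∷ []) ∷ (0 ∷ 7 ∷ 8 ∷ []) ∷ (0 ∷ 9 ∷ 10 ∷ []) ∷
    (1 ∷ 11 ∷ 12 ∷ []) ∷ (1 ∷ 9 ∷ 8 ∷ 6 ∷ []) ∷ (1 ∷ 5 ∷ 10 ∷ 7 ∷ []) ∷ (2 ∷ 6 ∷ 12 ∷ []) ∷
    (2 ∷ 11 ∷ 5 ∷ []) ∷ (3 ∷ 5 ∷ 12 ∷ []) ∷ (3 ∷ 6 ∷ 11 ∷ []) ∷ (4 ∷ 10 ∷ 8 ∷ []) ∷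
    (4 ∷ 7 ∷ 9 ∷ []) ∷ []) ∷
  ((1 ∷ 2 ∷ 3 ∷ []) ∷ (0 ∷ 4 ∷ 5 ∷ []) ∷ (0 ∷ 6 ∷ 7 ∷ []) ∷ (0 ∷ 8 ∷ 9 ∷ []) ∷
    (1 ∷ 10 ∷ 11 ∷ []) ∷ (1 ∷ 12 ∷ 13 ∷ []) ∷ (2 ∷ 13 ∷ 11 ∷ []) ∷ (2 ∷ 10 ∷ 12 ∷ []) ∷
    (3 ∷ 12 ∷ 11 ∷ []) ∷ (3 ∷ 13 ∷ 10 ∷ []) ∷ (4 ∷ 9 ∷ 7 ∷ []) ∷ (4 ∷ 6 ∷ 8 ∷ []) ∷
    (5 ∷ 8 ∷ 7 ∷ []) ∷ (5 ∷ 9 ∷ 6 ∷ []) ∷ []) ∷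
  []

maps : Vec Tables 53
maps = Vec.map toTables (Vec.fromList rotationSystems)

Injective : Vec ℕ n → Set
Injective xs = ∀ i j → Vec.lookup xs i ≡ Vec.lookup xs j → i ≡ j

injective? : ∀ (xs : Vec ℕ n) → Dec (Injective xs)
injective? xs = F.all? λ i → F.all? λ j → (_ ≟ _) →-dec (i F.≟ j)

certified : ∀ i → Certified (Vec.lookup maps i)
certified = VecAll.lookup⁺ (by-does (VecAll.all? certified? maps) refl)

signature-injective : Injective (Vec.map signatureOf maps)
signature-injective = by-does (injective? (Vec.map signatureOf maps)) refl

mainTheorem1 : Σ[ n ∈ (Fin 53 → ℕ) ] Σ[ M ∈ (∀ i → EmbeddedGraph (n i)) ]
    ((∀ i → Diminimal (M i)) × (∀ i j → i ≢ j → ¬ (M i ≅ M j)))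
mainTheorem1 = diminimalFamily (Vec.lookup maps) certified λ i j e →
  signature-injective i j
    (trans (Vec.lookup-map i signatureOf maps) (trans e (sym (Vec.lookup-map j signatureOf maps))))
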